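{- Let $\lambda$ be a partition, $n\ge1$, $0\le\ell\le n-1$, and let $\pi$ be the probability distribution on $\operatorname{TAZRP}(\lambda,n)$ given by $\pi(w)=\sum_{\sigma\in\operatorname{Tab}(\lambda,n),\ \operatorname{proj}(\sigma)=w}\operatorname{wt}(\sigma)\,/\,\sum_{\sigma\in\operatorname{Tab}(\lambda,n)}\operatorname{wt}(\sigma)$ (the stationary distribution of the mTAZRP). For any tuple $u=(u_1,\dots,u_\ell)$ of finite multisets, the probability $\pi(\{w\in\operatorname{TAZRP}(\lambda,n): w_i=u_i \text{ for } 1\le i\le \ell\})$, viewed as a rational function of $t,x_1,\dots,x_n$, is symmetric in the variables $x_{\ell+1},\dots,x_n$.
   Context: mTAZRP configurations: for a partition $\lambda=(\lambda_1\ge\dots\ge\lambda_k>0)$ and $n\ge1$, $\operatorname{TAZRP}(\lambda,n)$ is the set of tuples $w=(w_1,\dots,w_n)$ of (possibly empty) multisets of positive integers whose multiset union is $\{\lambda_1,\dots,\lambda_k\}$ ($w_j$ = species of particles at site $j$). Fillings: $\operatorname{dg}(\lambda)=\{(r,i):1\le i\le k,\ 1\le r\le\lambda_i\}$ (row $r$ from the bottom, column $i$ from the left). A filling is $\sigma:\operatorname{dg}(\lambda)\to[n]$; $\operatorname{Tab}(\lambda,n)$ is the set of fillings. Set $\sigma(\lambda_i+1,i):=0$. Let $\mathcal Q$ be the set of integer triples $(a,b,c)$ with $a<b<c$, or $b<c<a$, or $c<b<a$, or $a=b\ne c$. $\operatorname{quinv}(\sigma)$ is the number of pairs of cells $(r,i),(r,j)$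 with $i<j$ such that $(\sigma(r+1,i),\sigma(r,i),\sigma(r,j))\in\mathcal Q$. $\operatorname{wt}(\sigma)=t^{\operatorname{quinv}(\sigma)}\prod_{u}x_{\sigma(u)}$. $\operatorname{proj}(\sigma)=(w_1,\dots,w_n)$ with $w_j=\{\lambda_i:\sigma(1,i)=j\}$ as a multiset.
   Formalization: In the definition of 𝒬 the third case c<b<a is corrected to c<a<b (the cyclic rotation of a<b<c); as printed the claim fails, for example for λ=(2,2), n=3, ℓ=1, u₁={2}. -}

module Defs where

open import Data.Bool using (if_then_else_)
open import Data.Empty using (⊥-elim)
open import Data.Fin using (Fin; zero; suc; toℕ; inject≤)
import Data.Fin as Fin
import Data.Fin.Properties as Fin
open import Data.Fin.Permutation using (Permutation′; _⟨$⟩ʳ_; _⟨$⟩ˡ_; inverseˡ; lift₀)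
open import Data.Integer using (ℤ; +_; 0ℤ; 1ℤ)
import Data.Integer as ℤ
import Data.Integer.Properties as ℤ
open import Data.List using (List; []; _∷_; _++_; map; concat; concatMap; foldr; filter; length;
  upTo; allFin; cartesianProduct; cartesianProductWith; deduplicate)
import Data.List as List
open import Data.List.Membership.Propositional using (_∈_)
open import Data.List.Membership.Propositional.Properties using (∈-map⁺; ∈-concat⁺′; ∈-filter⁺;
  ∈-upTo⁺; ∈-allFin; ∈-cartesianProductWith⁺; ∈-∃++; ∈-lookup; ∈-deduplicate⁺)
open import Data.List.Properties using (length-++)
open import Data.List.Relation.Binary.Permutation.Propositional using (_↭_; ↭-refl; ↭-sym; ↭-trans;
  ↭-prep; ↭-isEquivalence)
open import Data.List.Relation.Binary.Permutation.Propositional.Properties using (∈-resp-↭; ↭-length;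
  ¬x∷xs↭[]; shift; drop-∷)
open import Data.List.Relation.Unary.All using (All; []; _∷_)
import Data.List.Relation.Unary.All as All
import Data.List.Relation.Unary.All.Properties as All
open import Data.List.Relation.Unary.AllPairs using ([]; _∷_)
open import Data.List.Relation.Unary.Any using (Any; here; there)
import Data.List.Relation.Unary.Any as Any
import Data.List.Relation.Unary.Any.Properties as Any
open import Data.List.Relation.Unary.Linked using (Linked)
open import Data.List.Relation.Unary.Unique.Propositional using (Unique)
import Data.List.Relation.Unary.Unique.Propositional.Properties as Unique
import Data.List.Relation.Unary.Unique.Setoid as SetoidUnique
import Data.List.Relation.Unary.Unique.DecSetoid.Properties as DecSetoidUnique
import Data.List.Relation.Unary.Unique.DecPropositional.Properties as DecUnique
open import Data.Nat using (ℕ; zero; suc; _+_; _<_; _≤_; _≥_; s≤s; NonZero)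
import Data.Nat as ℕ
import Data.Nat.Properties as ℕ
open import Data.List.Membership.DecPropositional ℕ._≟_ using (_∈?_)
open import Data.Product using (Σ-syntax; ∃-syntax; _×_; _,_; proj₁; proj₂)
open import Data.Sum using (_⊎_; inj₁; inj₂)
open import Data.Unit using (⊤; tt)
open import Data.Vec using (Vec; []; _∷_; lookup; tabulate; zipWith; replicate; toList; fromList;
  _[_]≔_)
import Data.Vec.Properties as Vec
open import Data.Vec.Relation.Binary.Pointwise.Inductive using (Pointwise)
import Data.Vec.Relation.Binary.Pointwise.Inductive as Pointwise
import Data.Vec.Relation.Unary.All as VecAll
open import Function using (_∘_)
open import Level using (0ℓ)
open import Relation.Binary using (DecSetoid; tri<; tri≈; tri>)
open import Relation.Binary.PropositionalEquality
open import Relation.Nullary using (Dec; yes; no; ¬_; ¬?; does; contradiction)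
open import Relation.Nullary.Decidable using (map′; _×-dec_; _⊎-dec_)
open import Relation.Unary using (Pred; Decidable)

------------------------------------------------------------------------
-- Polynomials over ℤ

-- Exponent vectors.
Monomial : ℕ → Set
Monomial m = Vec ℕ m

_≟ₘ_ : ∀ {m} (d e : Monomial m) → Dec (d ≡ e)
_≟ₘ_ = Vec.≡-dec ℕ._≟_

_·_ : ∀ {m} → Monomial m → Monomial m → Monomial m
_·_ = zipWith _+_

-- A polynomial is a formal sum of terms; terms may repeat, be zero, and come in
-- any order, so polynomials are compared by _≈_, not by _≡_.
Poly : ℕ → Set
Poly m = List (ℤ × Monomial m)

coeff : ∀ {m} → Poly m → Monomial m → ℤ
coeff []            e = 0ℤ
coeff ((a , d) ∷ p) e = (if does (d ≟ₘ e) then a else 0ℤ) ℤ.+ coeff p e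

infix 4 _≈_
_≈_ : ∀ {m} → Poly m → Poly m → Set
p ≈ q = ∀ e → coeff p e ≡ coeff q e

Nonzero : ∀ {m} → Poly m → Set
Nonzero p = ∃[ e ] coeff p e ≢ 0ℤ

0ₚ : ∀ {m} → Poly m
0ₚ = []

1ₚ : ∀ {m} → Poly m
1ₚ = (1ℤ , replicate _ 0) ∷ []

var : ∀ {m} → Fin m → Poly m
var i = (1ℤ , replicate _ 0 [ i ]≔ 1) ∷ []

_·ₜ_ : ∀ {m} → ℤ × Monomial m → ℤ × Monomial m → ℤ × Monomial m
(a , d) ·ₜ (b , e) = a ℤ.* b , d · e

infixl 6 _+ₚ_
infixl 7 _*ₚ_
infixr 8 _^ₚ_

_+ₚ_ : ∀ {m} → Poly m → Poly m → Poly m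
_+ₚ_ = _++_

_*ₚ_ : ∀ {m} → Poly m → Poly m → Poly m
_*ₚ_ = cartesianProductWith _·ₜ_

_^ₚ_ : ∀ {m} → Poly m → ℕ → Poly m
p ^ₚ zero  = 1ₚ
p ^ₚ suc k = p *ₚ p ^ₚ k

Σₚ : ∀ {m} → List (Poly m) → Poly m
Σₚ = foldr _+ₚ_ 0ₚ

Πₚ : ∀ {m} → List (Poly m) → Poly m
Πₚ = foldr _*ₚ_ 1ₚ

-- Substitution of the i-th variable by the (ρ i)-th one.
renameₘ : ∀ {m} → Permutation′ m → Monomial m → Monomial m
renameₘ ρ d = tabulate λ j → lookup d (ρ ⟨$⟩ˡ j)

renameₚ : ∀ {m} → Permutation′ m → Poly m → Poly m
renameₚ ρ = map λ (a , d) → a , renameₘ ρ d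

------------------------------------------------------------------------
-- ℤ[x₁,…,xₘ] has no zero divisors: the product of the lexicographically least
-- terms of p and q cannot cancel in p *ₚ q.

module _ {m : ℕ} where

  δ : Monomial m → Monomial m → ℤ
  δ d e = if does (d ≟ₘ e) then 1ℤ else 0ℤ

  δ-refl : ∀ d → δ d d ≡ 1ℤ
  δ-refl d with d ≟ₘ d
  ... | yes _ = refl
  ... | no ¬p = contradiction refl ¬p

  δ-≢ : ∀ {d e} → d ≢ e → δ d e ≡ 0ℤ
  δ-≢ {d} {e} d≢e with d ≟ₘ e
  ... | yes p = contradiction p d≢e
  ... | no _  = refl

  ite : ∀ a (d e : Monomial m) → (if does (d ≟ₘ e) then a else 0ℤ) ≡ a ℤ.* δ d e
  ite a d e with d ≟ₘ e
  ... | yes _ = sym (ℤ.*-identityʳ a)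
  ... | no _  = sym (ℤ.*-zeroʳ a)

  weigh : Poly m → (Monomial m → ℤ) → ℤ
  weigh []            g = 0ℤ
  weigh ((a , d) ∷ p) g = a ℤ.* g d ℤ.+ weigh p g

  coeff-++ : ∀ p q e → coeff {m} (p ++ q) e ≡ coeff p e ℤ.+ coeff q e
  coeff-++ []      q e = sym (ℤ.+-identityˡ _)
  coeff-++ ((a , d) ∷ p) q e = trans (cong (ℤ._+_ c) (coeff-++ p q e)) (sym (ℤ.+-assoc c _ _))
    where c = if does (d ≟ₘ e) then a else 0ℤ

  coeff-term : ∀ a d q e →
    coeff (map ((a , d) ·ₜ_) q) e ≡ a ℤ.* weigh q (λ f → δ (d · f) e)
  coeff-term a d []            e = sym (ℤ.*-zeroʳ a)
  coeff-term a d ((b , f) ∷ q) e = trans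
    (cong₂ ℤ._+_ (trans (ite (a ℤ.* b) (d · f) e) (ℤ.*-assoc a b _)) (coeff-term a d q e))
    (sym (ℤ.*-distribˡ-+ a _ _))

  coeff-* : ∀ p q e → coeff (p *ₚ q) e ≡ weigh p (λ d → weigh q (λ f → δ (d · f) e))
  coeff-* []            q e = refl
  coeff-* ((a , d) ∷ p) q e = trans (coeff-++ (map ((a , d) ·ₜ_) q) (p *ₚ q) e)
    (cong₂ ℤ._+_ (coeff-term a d q e) (coeff-* p q e))

  sumOver : List (Monomial m) → (Monomial m → ℤ) → ℤ
  sumOver []       h = 0ℤ
  sumOver (e ∷ es) h = h e ℤ.+ sumOver es h

  sumOver-zero : ∀ es {h} → (∀ e → e ∈ es → h e ≡ 0ℤ) → sumOver es h ≡ 0ℤ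
  sumOver-zero []       h≡0 = refl
  sumOver-zero (e ∷ es) h≡0 =
    cong₂ ℤ._+_ (h≡0 e (here refl)) (sumOver-zero es λ f f∈ → h≡0 f (there f∈))

  sumOver-single : ∀ {es e₀} h → Unique es → e₀ ∈ es →
    (∀ e → e ≢ e₀ → h e ≡ 0ℤ) → sumOver es h ≡ h e₀
  sumOver-single {e ∷ es} h (e∉ ∷ _) (here refl) h≡0 = trans
    (cong (ℤ._+_ (h e)) (sumOver-zero es λ f f∈ → h≡0 f λ f≡e → All.lookup e∉ f∈ (sym f≡e)))
    (ℤ.+-identityʳ _)
  sumOver-single {e ∷ es} h (e∉ ∷ u) (there e₀∈) h≡0 = trans
    (cong₂ ℤ._+_ (h≡0 e (All.lookup e∉ e₀∈)) (sumOver-single h u e₀∈ h≡0))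
    (ℤ.+-identityˡ _)

  sumOver-+ : ∀ es h k → sumOver es (λ e → h e ℤ.+ k e) ≡ sumOver es h ℤ.+ sumOver es k
  sumOver-+ []       h k = refl
  sumOver-+ (e ∷ es) h k = trans (cong (ℤ._+_ (h e ℤ.+ k e)) (sumOver-+ es h k))
    (interchange (h e) (k e) _ _)
    where
    interchange : ∀ a b c d → (a ℤ.+ b) ℤ.+ (c ℤ.+ d) ≡ (a ℤ.+ c) ℤ.+ (b ℤ.+ d)
    interchange a b c d = trans (ℤ.+-assoc a b (c ℤ.+ d)) (trans
      (cong (ℤ._+_ a) (trans (sym (ℤ.+-assoc b c d)) (trans (cong (ℤ._+ d) (ℤ.+-comm b c))
        (ℤ.+-assoc c b d))))
      (sym (ℤ.+-assoc a c (b ℤ.+ d))))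

  sumOver-cong : ∀ es {h k} → (∀ e → h e ≡ k e) → sumOver es h ≡ sumOver es k
  sumOver-cong []       eq = refl
  sumOver-cong (e ∷ es) eq = cong₂ ℤ._+_ (eq e) (sumOver-cong es eq)

  weigh-sumOver : ∀ {es} → Unique es → ∀ p g → (∀ e → e ∈ map proj₂ p → e ∈ es) →
    weigh p g ≡ sumOver es (λ e → coeff p e ℤ.* g e)
  weigh-sumOver {es} u []            g sub = sym (sumOver-zero es λ _ _ → refl)
  weigh-sumOver {es} u ((a , d) ∷ p) g sub = begin
    a ℤ.* g d ℤ.+ weigh p g
      ≡⟨ cong₂ ℤ._+_
           (sym (trans (sumOver-single (λ e → a ℤ.* δ d e ℤ.* g e) u (sub d (here refl)) off) on))
           (weigh-sumOver u p g λ e e∈ → sub e (there e∈)) ⟩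
    sumOver es (λ e → a ℤ.* δ d e ℤ.* g e) ℤ.+ sumOver es (λ e → coeff p e ℤ.* g e)
      ≡⟨ sumOver-+ es _ _ ⟨
    sumOver es (λ e → a ℤ.* δ d e ℤ.* g e ℤ.+ coeff p e ℤ.* g e)
      ≡⟨ sumOver-cong es (λ e → trans (sym (ℤ.*-distribʳ-+ (g e) (a ℤ.* δ d e) (coeff p e)))
           (cong (λ z → (z ℤ.+ coeff p e) ℤ.* g e) (sym (ite a d e)))) ⟩
    sumOver es (λ e → coeff ((a , d) ∷ p) e ℤ.* g e) ∎
    where
    open ≡-Reasoning
    on : a ℤ.* δ d d ℤ.* g d ≡ a ℤ.* g d
    on = cong (ℤ._* g d) (trans (cong (a ℤ.*_) (δ-refl d)) (ℤ.*-identityʳ a))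
    off : ∀ e → e ≢ d → a ℤ.* δ d e ℤ.* g e ≡ 0ℤ
    off e e≢d = cong (ℤ._* g e)
      (trans (cong (a ℤ.*_) (δ-≢ (e≢d ∘ sym))) (ℤ.*-zeroʳ a))

  support : Poly m → List (Monomial m)
  support p = deduplicate _≟ₘ_ (map proj₂ p)

  support-unique : ∀ p → Unique (support p)
  support-unique p = DecUnique.deduplicate-! _≟ₘ_ (map proj₂ p)

  weigh-support : ∀ p g → weigh p g ≡ sumOver (support p) (λ e → coeff p e ℤ.* g e)
  weigh-support p g =
    weigh-sumOver (support-unique p) p g (λ e → ∈-deduplicate⁺ _≟ₘ_)

  coeff≢0⇒∈ : ∀ (p : Poly m) {e} → coeff p e ≢ 0ℤ → e ∈ map proj₂ p
  coeff≢0⇒∈ []            c≢0 = contradiction refl c≢0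
  coeff≢0⇒∈ ((a , d) ∷ p) {e} c≢0 with d ≟ₘ e
  ... | yes d≡e = here (sym d≡e)
  ... | no _    = there (coeff≢0⇒∈ p (c≢0 ∘ trans (ℤ.+-identityˡ _)))

_≼_ : ∀ {m} → Monomial m → Monomial m → Set
[]      ≼ []      = ⊤
(a ∷ d) ≼ (b ∷ e) = a < b ⊎ (a ≡ b × d ≼ e)

≼-refl : ∀ {m} (d : Monomial m) → d ≼ d
≼-refl []      = tt
≼-refl (a ∷ d) = inj₂ (refl , ≼-refl d)

≼-trans : ∀ {m} (d e f : Monomial m) → d ≼ e → e ≼ f → d ≼ f
≼-trans []      []      []      _ _ = tt
≼-trans (_ ∷ d) (_ ∷ e) (_ ∷ f) (inj₁ p)          (inj₁ q)          = inj₁ (ℕ.<-trans p q)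
≼-trans (_ ∷ d) (_ ∷ e) (_ ∷ f) (inj₁ p)          (inj₂ (refl , _)) = inj₁ p
≼-trans (_ ∷ d) (_ ∷ e) (_ ∷ f) (inj₂ (refl , _)) (inj₁ q)          = inj₁ q
≼-trans (_ ∷ d) (_ ∷ e) (_ ∷ f) (inj₂ (refl , p)) (inj₂ (refl , q)) =
  inj₂ (refl , ≼-trans d e f p q)

≼-total : ∀ {m} (d e : Monomial m) → d ≼ e ⊎ e ≼ d
≼-total []      []      = inj₁ tt
≼-total (a ∷ d) (b ∷ e) with ℕ.<-cmp a b
... | tri< a<b _ _  = inj₁ (inj₁ a<b)
... | tri> _ _ b<a  = inj₂ (inj₁ b<a)
... | tri≈ _ refl _ with ≼-total d e
...   | inj₁ p = inj₁ (inj₂ (refl , p))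
...   | inj₂ p = inj₂ (inj₂ (refl , p))

≼-cancel : ∀ {m} (d₀ d e₀ e : Monomial m) → d₀ ≼ d → e₀ ≼ e → d · e ≡ d₀ · e₀ →
  d ≡ d₀ × e ≡ e₀
≼-cancel []       []      []       []      _ _ _ = refl , refl
≼-cancel (a₀ ∷ d₀) (a ∷ d) (b₀ ∷ e₀) (b ∷ e) p q eq
  with Vec.∷-injective eq
... | eq₁ , eq₂ with p | q
...   | inj₁ a₀<a       | inj₁ b₀<b       =
  ⊥-elim (ℕ.<-irrefl (sym eq₁) (ℕ.+-mono-< a₀<a b₀<b))
...   | inj₁ a₀<a       | inj₂ (refl , _) =
  ⊥-elim (ℕ.<-irrefl (sym eq₁) (ℕ.+-monoˡ-< b₀ a₀<a))
...   | inj₂ (refl , _) | inj₁ b₀<b       =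
  ⊥-elim (ℕ.<-irrefl (sym eq₁) (ℕ.+-monoʳ-< a₀ b₀<b))
...   | inj₂ (refl , r) | inj₂ (refl , s) with ≼-cancel d₀ d e₀ e r s eq₂
...     | refl , refl = refl , refl

least : ∀ {m} {P : Pred (Monomial m) 0ℓ} → Decidable P → ∀ es {e} → P e →
  ∃[ e₀ ] P e₀ × e₀ ≼ e × (∀ f → f ∈ es → P f → e₀ ≼ f)
least P? []       {e} Pe = e , Pe , ≼-refl e , λ _ ()
least P? (d ∷ es) {e} Pe with least P? es Pe
... | e₁ , Pe₁ , e₁≼e , min with P? d
...   | no ¬Pd = e₁ , Pe₁ , e₁≼e , λ where
  f (here refl) Pf → contradiction Pf ¬Pd
  f (there f∈)  Pf → min f f∈ Pf
...   | yes Pd with ≼-total e₁ d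
...     | inj₁ e₁≼d = e₁ , Pe₁ , e₁≼e , λ where
  f (here refl) _  → e₁≼d
  f (there f∈)  Pf → min f f∈ Pf
...     | inj₂ d≼e₁ = d , Pd , ≼-trans d e₁ e d≼e₁ e₁≼e , λ where
  f (here refl) _  → ≼-refl d
  f (there f∈)  Pf → ≼-trans d e₁ f d≼e₁ (min f f∈ Pf)

lowest : ∀ {m} (p : Poly m) → Nonzero p →
  ∃[ e₀ ] coeff p e₀ ≢ 0ℤ × (∀ e → coeff p e ≢ 0ℤ → e₀ ≼ e)
lowest p (e , c≢0) with least (λ f → ¬? (coeff p f ℤ.≟ 0ℤ)) (map proj₂ p) c≢0
... | e₀ , c₀≢0 , _ , min = e₀ , c₀≢0 , λ f cf≢0 → min f (coeff≢0⇒∈ p cf≢0) cf≢0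

*ₚ-nonzero : ∀ {m} (p q : Poly m) → Nonzero p → Nonzero q → Nonzero (p *ₚ q)
*ₚ-nonzero {m} p q p≢0 q≢0 with lowest p p≢0 | lowest q q≢0
... | d₀ , cp≢0 , minp | e₀ , cq≢0 , minq = d₀ · e₀ , λ c≡0 → nz (trans (sym lead) c≡0)
  where
  g : Monomial m → ℤ
  g d = weigh q (λ f → δ (d · f) (d₀ · e₀))

  ∈support : ∀ (r : Poly m) {e} → coeff r e ≢ 0ℤ → e ∈ support r
  ∈support r c≢0 = ∈-deduplicate⁺ _≟ₘ_ (coeff≢0⇒∈ r c≢0)

  off : ∀ d f → ¬ (d ≡ d₀ × f ≡ e₀) → coeff p d ≢ 0ℤ → coeff q f ℤ.* δ (d · f) (d₀ · e₀) ≡ 0ℤ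
  off d f ≢₀ c≢0 with coeff q f ℤ.≟ 0ℤ
  ... | yes z = cong (ℤ._* δ (d · f) (d₀ · e₀)) z
  ... | no nz = trans
    (cong (coeff q f ℤ.*_) (δ-≢ λ eq → ≢₀ (≼-cancel d₀ d e₀ f (minp d c≢0) (minq f nz) eq)))
    (ℤ.*-zeroʳ (coeff q f))

  offp : ∀ d → d ≢ d₀ → coeff p d ℤ.* g d ≡ 0ℤ
  offp d d≢ with coeff p d ℤ.≟ 0ℤ
  ... | yes z = cong (ℤ._* g d) z
  ... | no nz = trans (cong (coeff p d ℤ.*_) (trans (weigh-support q _)
    (sumOver-zero (support q) λ f _ → off d f (d≢ ∘ proj₁) nz))) (ℤ.*-zeroʳ (coeff p d))

  g₀ : g d₀ ≡ coeff q e₀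
  g₀ = trans (weigh-support q _) (trans
    (sumOver-single _ (support-unique q) (∈support q cq≢0)
      λ f f≢ → off d₀ f (f≢ ∘ proj₂) cp≢0)
    (trans (cong (coeff q e₀ ℤ.*_) (δ-refl (d₀ · e₀))) (ℤ.*-identityʳ _)))

  lead : coeff (p *ₚ q) (d₀ · e₀) ≡ coeff p d₀ ℤ.* coeff q e₀
  lead = trans (coeff-* p q (d₀ · e₀)) (trans (weigh-support p g) (trans
    (sumOver-single _ (support-unique p) (∈support p cp≢0) offp)
    (cong (coeff p d₀ ℤ.*_) g₀)))

  nz : coeff p d₀ ℤ.* coeff q e₀ ≢ 0ℤ
  nz eq with ℤ.i*j≡0⇒i≡0∨j≡0 (coeff p d₀) eq
  ... | inj₁ z = cp≢0 z
  ... | inj₂ z = cq≢0 z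

1ₚ-nonzero : ∀ {m} → Nonzero (1ₚ {m})
1ₚ-nonzero {m} = replicate _ 0 , λ eq →
  contradiction (trans (sym (trans (ℤ.+-identityʳ _) (δ-refl (replicate m 0)))) eq) λ ()

renameₘ-injective : ∀ {m} (ρ : Permutation′ m) {d e} → renameₘ ρ d ≡ renameₘ ρ e → d ≡ e
renameₘ-injective ρ {d} {e} eq = trans (sym (Vec.tabulate∘lookup d)) (trans
  (Vec.tabulate-cong λ i → begin
    lookup d i                         ≡⟨ cong (lookup d) (inverseˡ ρ) ⟨
    lookup d (ρ ⟨$⟩ˡ (ρ ⟨$⟩ʳ i))      ≡⟨ Vec.lookup∘tabulate _ (ρ ⟨$⟩ʳ i) ⟨
    lookup (renameₘ ρ d) (ρ ⟨$⟩ʳ i)   ≡⟨ cong (λ f → lookup f (ρ ⟨$⟩ʳ i)) eq ⟩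
    lookup (renameₘ ρ e) (ρ ⟨$⟩ʳ i)   ≡⟨ Vec.lookup∘tabulate _ (ρ ⟨$⟩ʳ i) ⟩
    lookup e (ρ ⟨$⟩ˡ (ρ ⟨$⟩ʳ i))      ≡⟨ cong (lookup e) (inverseˡ ρ) ⟩
    lookup e i                         ∎)
  (Vec.tabulate∘lookup e))
  where open ≡-Reasoning

coeff-rename : ∀ {m} (ρ : Permutation′ m) p e → coeff (renameₚ ρ p) (renameₘ ρ e) ≡ coeff p e
coeff-rename ρ []            e = refl
coeff-rename ρ ((a , d) ∷ p) e = cong₂ ℤ._+_ head (coeff-rename ρ p e)
  where
  head : (if does (renameₘ ρ d ≟ₘ renameₘ ρ e) then a else 0ℤ) ≡
         (if does (d ≟ₘ e) then a else 0ℤ)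
  head with renameₘ ρ d ≟ₘ renameₘ ρ e | d ≟ₘ e
  ... | yes _  | yes _  = refl
  ... | yes eq | no ¬eq = contradiction (renameₘ-injective ρ eq) ¬eq
  ... | no ¬eq | yes eq = contradiction (cong (renameₘ ρ) eq) ¬eq
  ... | no _   | no _   = refl

renameₚ-nonzero : ∀ {m} (ρ : Permutation′ m) p → Nonzero p → Nonzero (renameₚ ρ p)
renameₚ-nonzero ρ p (e , c≢0) = renameₘ ρ e , c≢0 ∘ trans (sym (coeff-rename ρ p e))

------------------------------------------------------------------------
-- Rational functions

record RationalFunction (m : ℕ) : Set where
  constructor _/_⟨_⟩
  field
    num         : Poly m
    den         : Poly m
    den-nonzero : Nonzero den

open RationalFunction public

infix 4 _≃_
_≃_ : ∀ {m} → RationalFunction m → RationalFunction m → Set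
f ≃ g = num f *ₚ den g ≈ num g *ₚ den f

0ᵣ : ∀ {m} → RationalFunction m
0ᵣ = 0ₚ / 1ₚ ⟨ 1ₚ-nonzero ⟩

_+ᵣ_ : ∀ {m} → RationalFunction m → RationalFunction m → RationalFunction m
(p / q ⟨ q≢0 ⟩) +ᵣ (r / s ⟨ s≢0 ⟩) = (p *ₚ s +ₚ r *ₚ q) / q *ₚ s ⟨ *ₚ-nonzero q s q≢0 s≢0 ⟩

Σᵣ : ∀ {m} → List (RationalFunction m) → RationalFunction m
Σᵣ = foldr _+ᵣ_ 0ᵣ

rename : ∀ {m} → Permutation′ m → RationalFunction m → RationalFunction m
rename ρ (p / q ⟨ q≢0 ⟩) = renameₚ ρ p / renameₚ ρ q ⟨ renameₚ-nonzero ρ q q≢0 ⟩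

-- Rational functions in t, x₁, …, xₙ: variable zero is t and variable suc i is
-- x_{i+1}; lift₀ ρ fixes t and sends x_{i+1} to x_{ρ(i)+1}.
SymmetricBeyond : ∀ {n} → ℕ → RationalFunction (suc n) → Set
SymmetricBeyond {n} ℓ f =
  (ρ : Permutation′ n) → (∀ i → toℕ i < ℓ → ρ ⟨$⟩ʳ i ≡ i) → rename (lift₀ ρ) f ≃ f

------------------------------------------------------------------------
-- Finite enumerations

vecs : ∀ {A : Set} → List A → ∀ k → List (Vec A k)
vecs xs zero    = [] ∷ []
vecs xs (suc k) = cartesianProductWith _∷_ xs (vecs xs k)

∈-vecs : ∀ {A : Set} {xs : List A} {k} {v : Vec A k} → VecAll.All (_∈ xs) v → v ∈ vecs xs k
∈-vecs VecAll.[]         = here refl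
∈-vecs (a∈ VecAll.∷ as∈) = ∈-cartesianProductWith⁺ _∷_ a∈ (∈-vecs as∈)

vecs-unique : ∀ {A : Set} {xs : List A} → Unique xs → ∀ k → Unique (vecs xs k)
vecs-unique u zero    = [] ∷ []
vecs-unique u (suc k) =
  Unique.cartesianProductWith⁺ _∷_ Vec.∷-injective u (vecs-unique u k)

listsUpTo : ∀ {A : Set} → List A → ℕ → List (List A)
listsUpTo xs k = concatMap (λ j → map toList (vecs xs j)) (upTo (suc k))

∈-listsUpTo : ∀ {A : Set} {xs : List A} {k} ys → All (_∈ xs) ys → length ys ≤ k →
  ys ∈ listsUpTo xs k
∈-listsUpTo {xs = xs} ys ys⊆ len = ∈-concat⁺′
  (subst (_∈ map toList (vecs xs (length ys))) (Vec.toList∘fromList ys)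
    (∈-map⁺ toList (∈-vecs (fromList⁺ ys⊆))))
  (∈-map⁺ (λ j → map toList (vecs xs j)) (∈-upTo⁺ (s≤s len)))
  where
  fromList⁺ : ∀ {zs} → All (_∈ xs) zs → VecAll.All (_∈ xs) (fromList zs)
  fromList⁺ []       = VecAll.[]
  fromList⁺ (p ∷ ps) = p VecAll.∷ fromList⁺ ps

------------------------------------------------------------------------
-- Partitions and TAZRP configurations

record Partition : Set where
  field
    parts      : List ℕ
    positive   : All (0 <_) parts
    decreasing : Linked _≥_ parts

open Partition public

-- A finite multiset is a list up to _↭_.
Multiset : Set
Multiset = List ℕ

_↭?_ : (xs ys : Multiset) → Dec (xs ↭ ys)
[]       ↭? []       = yes ↭-refl
[]       ↭? (y ∷ ys) = no (¬x∷xs↭[] ∘ ↭-sym)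
(x ∷ xs) ↭? ys with x ∈? ys
... | no x∉ = no λ p → x∉ (∈-resp-↭ p (here refl))
... | yes x∈ with ∈-∃++ x∈
...   | as , bs , refl = map′
  (λ p → ↭-trans (↭-prep x p) (↭-sym (shift x as bs)))
  (λ p → drop-∷ (↭-trans p (shift x as bs)))
  (xs ↭? (as ++ bs))

-- Entry j is the multiset of species of the particles at site j + 1.
Config : ℕ → Set
Config n = Vec Multiset n

Config-decSetoid : ℕ → DecSetoid 0ℓ 0ℓ
Config-decSetoid n = record
  { Carrier          = Config n
  ; _≈_              = Pointwise _↭_
  ; isDecEquivalence = Pointwise.isDecEquivalence
      (record { isEquivalence = ↭-isEquivalence ; _≟_ = _↭?_ }) n
  }

infix 4 _≈ᶜ_ _≈ᶜ?_
_≈ᶜ_ : ∀ {n} → Config n → Config n → Set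
_≈ᶜ_ {n} = DecSetoid._≈_ (Config-decSetoid n)

_≈ᶜ?_ : ∀ {n} (v w : Config n) → Dec (v ≈ᶜ w)
_≈ᶜ?_ {n} = DecSetoid._≟_ (Config-decSetoid n)

IsTAZRP : ∀ Λ {n} → Config n → Set
IsTAZRP Λ w = concat (toList w) ↭ parts Λ

IsTAZRP? : ∀ Λ {n} → Decidable (IsTAZRP Λ {n})
IsTAZRP? Λ w = concat (toList w) ↭? parts Λ

-- The finite set TAZRP(Λ, n): by the three lemmas below, the list contains exactly
-- one representative of every configuration.
TAZRP : Partition → ∀ n → List (Config n)
TAZRP Λ n = deduplicate _≈ᶜ?_
  (filter (IsTAZRP? Λ) (vecs (listsUpTo (parts Λ) (length (parts Λ))) n))

TAZRP-sound : ∀ Λ n → All (IsTAZRP Λ) (TAZRP Λ n)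
TAZRP-sound Λ n = All.deduplicate⁺ _≈ᶜ?_
  (All.all-filter (IsTAZRP? Λ) (vecs (listsUpTo (parts Λ) (length (parts Λ))) n))

TAZRP-complete : ∀ Λ n w → IsTAZRP Λ w → Any (w ≈ᶜ_) (TAZRP Λ n)
TAZRP-complete Λ n w isT = Any.deduplicate⁺ _≈ᶜ?_
  (λ y≈x w≈x → S.trans w≈x (S.sym y≈x))
  (Any.map S.reflexive (∈-filter⁺ (IsTAZRP? Λ) (∈-vecs (sites w λ _ x → x)) isT))
  where
  module S = DecSetoid (Config-decSetoid n)

  ∈parts : ∀ {x} → x ∈ concat (toList w) → x ∈ parts Λ
  ∈parts = ∈-resp-↭ isT

  sites : ∀ {k} (v : Config k) →
    (∀ ys → ys ∈ toList v → ys ∈ toList w) →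
    VecAll.All (_∈ listsUpTo (parts Λ) (length (parts Λ))) v
  sites []       sub = VecAll.[]
  sites (ys ∷ v) sub = ∈-listsUpTo ys
    (All.tabulate λ y∈ → ∈parts (∈-concat⁺′ y∈ (sub ys (here refl))))
    (subst (length ys ≤_) (↭-length isT) (shorter (toList w) (sub ys (here refl))))
    VecAll.∷ sites v λ zs zs∈ → sub zs (there zs∈)
    where
    shorter : ∀ yss → ys ∈ yss → length ys ≤ length (concat yss)
    shorter (.ys ∷ yss) (here refl) = subst (length ys ≤_) (sym (length-++ ys)) (ℕ.m≤m+n _ _)
    shorter (zs ∷ yss)  (there p)   = subst (length ys ≤_) (sym (length-++ zs))
      (ℕ.≤-trans (shorter yss p) (ℕ.m≤n+m _ (length zs)))

TAZRP-unique : ∀ Λ n → SetoidUnique.Unique (DecSetoid.setoid (Config-decSetoid n)) (TAZRP Λ n)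
TAZRP-unique Λ n = DecSetoidUnique.deduplicate-! (Config-decSetoid n) _

------------------------------------------------------------------------
-- Fillings

-- Diagrams and fillings are defined for any list of column heights; (i , r) is the
-- cell in column i + 1 and row r + 1.
Cell : List ℕ → Set
Cell ps = Σ[ i ∈ Fin (length ps) ] Fin (List.lookup ps i)

dg : ∀ ps → List (Cell ps)
dg ps = concatMap (λ i → map (i ,_) (allFin _)) (allFin (length ps))

-- A filling is given by its columns, each read from the bottom; the element i of
-- Fin n stands for i + 1 ∈ [n].
Filling : List ℕ → ℕ → Set
Filling ps n = All (Vec (Fin n)) ps

column : ∀ {ps n} → Filling ps n → (i : Fin (length ps)) → Vec (Fin n) (List.lookup ps i)
column {ps} σ i = All.lookup σ (∈-lookup {xs = ps} i)

_at_ : ∀ {ps n} → Filling ps n → Cell ps → Fin n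
σ at (i , r) = lookup (column σ i) r

Tab : ∀ ps n → List (Filling ps n)
Tab []       n = [] ∷ []
Tab (p ∷ ps) n = cartesianProductWith _∷_ (vecs (allFin n) p) (Tab ps n)

Tab-complete : ∀ {ps n} (σ : Filling ps n) → σ ∈ Tab ps n
Tab-complete []      = here refl
Tab-complete (c ∷ σ) =
  ∈-cartesianProductWith⁺ _∷_ (∈-vecs (VecAll.universal ∈-allFin c)) (Tab-complete σ)

Tab-unique : ∀ ps n → Unique (Tab ps n)
Tab-unique []       n = [] ∷ []
Tab-unique (p ∷ ps) n = Unique.cartesianProductWith⁺ _∷_ (λ where refl → refl , refl)
  (vecs-unique (Unique.allFin⁺ n) p) (Tab-unique ps n)

-- The value in [n] at the given height of a column, or 0 above its top.
valueAt : ∀ {n p} → Vec (Fin n) p → ℕ → ℕ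
valueAt []      _       = 0
valueAt (a ∷ c) zero    = suc (toℕ a)
valueAt (a ∷ c) (suc r) = valueAt c r

value : ∀ {ps n} → Filling ps n → Cell ps → ℕ
value σ (i , r) = valueAt (column σ i) (toℕ r)

above : ∀ {ps n} → Filling ps n → Cell ps → ℕ
above σ (i , r) = valueAt (column σ i) (suc (toℕ r))

bottom : ∀ {ps n} → Filling ps n → Fin (length ps) → ℕ
bottom σ i = valueAt (column σ i) 0

-- The first three cases say that a, b, c are distinct and increase cyclically. The
-- third is c < a < b; with c < b < a instead, the weights would not yield a
-- symmetric distribution (it already fails for the partition (2,2) and n = 3).
𝒬 : ℕ → ℕ → ℕ → Set
𝒬 a b c = (a < b × b < c) ⊎ (b < c × c < a) ⊎ (c < a × a < b) ⊎ (a ≡ b × b ≢ c)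

𝒬? : ∀ a b c → Dec (𝒬 a b c)
𝒬? a b c = (a ℕ.<? b ×-dec b ℕ.<? c) ⊎-dec (b ℕ.<? c ×-dec c ℕ.<? a) ⊎-dec
           (c ℕ.<? a ×-dec a ℕ.<? b) ⊎-dec (a ℕ.≟ b ×-dec ¬? (b ℕ.≟ c))

QuinvPair : ∀ {ps n} → Filling ps n → Cell ps × Cell ps → Set
QuinvPair σ (u@(i , r) , v@(j , s)) =
  toℕ r ≡ toℕ s × i Fin.< j × 𝒬 (above σ u) (value σ u) (value σ v)

QuinvPair? : ∀ {ps n} (σ : Filling ps n) → Decidable (QuinvPair σ)
QuinvPair? σ ((i , r) , (j , s)) = toℕ r ℕ.≟ toℕ s ×-dec (i Fin.<? j ×-dec 𝒬? _ _ _)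

quinv : ∀ {ps n} → Filling ps n → ℕ
quinv {ps} σ = length (filter (QuinvPair? σ) (cartesianProduct (dg ps) (dg ps)))

t : ∀ {n} → Poly (suc n)
t = var zero

x : ∀ {n} → Fin n → Poly (suc n)
x i = var (suc i)

wt : ∀ {ps n} → Filling ps n → Poly (suc n)
wt {ps} σ = t ^ₚ quinv σ *ₚ Πₚ (map (λ u → x (σ at u)) (dg ps))

proj : ∀ {ps n} → Filling ps n → Config n
proj {ps} σ = tabulate λ j → map (List.lookup ps)
  (filter (λ i → bottom σ i ℕ.≟ suc (toℕ j)) (allFin (length ps)))

------------------------------------------------------------------------
-- The distribution π

partitionFunction : ∀ Λ n → Poly (suc n)
partitionFunction Λ n = Σₚ (map wt (Tab (parts Λ) n))

private
  -- p is a nonempty sum of monomials with coefficient 1.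
  Ones : ∀ {m} → Poly m → Set
  Ones p = p ≢ [] × All ((_≡ 1ℤ) ∘ proj₁) p

  ones-* : ∀ {m} {p q : Poly m} → Ones p → Ones q → Ones (p *ₚ q)
  ones-* {p = p} {q} (p≢ , ap) (q≢ , aq) = ne p q p≢ q≢ ,
    All.cartesianProductWith⁺ (setoid _) (setoid _) _·ₜ_ p q
      λ u∈ v∈ → cong₂ ℤ._*_ (All.lookup ap u∈) (All.lookup aq v∈)
    where
    ne : ∀ p q → p ≢ [] → q ≢ [] → p *ₚ q ≢ []
    ne []      q       p≢ q≢ = contradiction refl p≢
    ne (_ ∷ _) []      p≢ q≢ = contradiction refl q≢
    ne (_ ∷ _) (_ ∷ _) p≢ q≢ = λ ()

  ones-1 : ∀ {m} → Ones (1ₚ {m})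
  ones-1 = (λ ()) , refl ∷ []

  ones-var : ∀ {m} (i : Fin m) → Ones (var i)
  ones-var i = (λ ()) , refl ∷ []

  ones-^ : ∀ {m} {p : Poly m} → Ones p → ∀ k → Ones (p ^ₚ k)
  ones-^ op zero    = ones-1
  ones-^ op (suc k) = ones-* op (ones-^ op k)

  ones-Π : ∀ {m} {A : Set} (f : A → Poly m) → (∀ a → Ones (f a)) → ∀ as → Ones (Πₚ (map f as))
  ones-Π f of []       = ones-1
  ones-Π f of (a ∷ as) = ones-* (of a) (ones-Π f of as)

  ones-wt : ∀ {ps n} (σ : Filling ps n) → Ones (wt σ)
  ones-wt {ps} σ = ones-* (ones-^ (ones-var zero) (quinv σ))
    (ones-Π _ (λ u → ones-var (suc (σ at u))) (dg ps))

  ones-Σ : ∀ {m} {A : Set} (f : A → Poly m) → (∀ a → Ones (f a)) → ∀ {as} {a} → a ∈ as →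
    Ones (Σₚ (map f as))
  ones-Σ {A = A} f of {a ∷ as} _ = ne (f a) (proj₁ (of a)) , all (a ∷ as)
    where
    ne : ∀ p → p ≢ [] → p ++ Σₚ (map f as) ≢ []
    ne []      p≢ = contradiction refl p≢
    ne (_ ∷ _) p≢ = λ ()
    all : ∀ as → All ((_≡ 1ℤ) ∘ proj₁) (Σₚ (map f as))
    all []       = []
    all (a ∷ as) = All.++⁺ (proj₂ (of a)) (all as)

  ones-nonzero : ∀ {m} (p : Poly m) → Ones p → Nonzero p
  ones-nonzero []            (p≢ , _)        = contradiction refl p≢
  ones-nonzero ((_ , d) ∷ p) (_ , refl ∷ ap) = d , pos
    where
    natural : ∀ p → All ((_≡ 1ℤ) ∘ proj₁) p → ∃[ k ] coeff p d ≡ + k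
    natural []            []          = 0 , refl
    natural ((_ , e) ∷ p) (refl ∷ ap) with e ≟ₘ d | natural p ap
    ... | yes _ | k , eq = suc k , cong (ℤ._+_ 1ℤ) eq
    ... | no _  | k , eq = k , cong (ℤ._+_ 0ℤ) eq
    pos : coeff ((1ℤ , d) ∷ p) d ≢ 0ℤ
    pos eq with natural p ap
    ... | k , ck = contradiction (trans (sym (cong₂ ℤ._+_ (δ-refl d) ck)) eq) λ ()

partitionFunction-nonzero : ∀ Λ n .{{_ : NonZero n}} → Nonzero (partitionFunction Λ n)
partitionFunction-nonzero Λ (suc n) = ones-nonzero (partitionFunction Λ (suc n))
  (ones-Σ wt ones-wt (Tab-complete (All.universal (λ p → replicate p zero) (parts Λ))))

π : ∀ Λ n .{{_ : NonZero n}} → Config n → RationalFunction (suc n)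
π Λ n w = Σₚ (map wt (filter (λ σ → proj σ ≈ᶜ? w) (Tab (parts Λ) n)))
        / partitionFunction Λ n ⟨ partitionFunction-nonzero Λ n ⟩

-- The π-probability of the event { w ∈ TAZRP(Λ, n) : E w }.
Pr : ∀ Λ n .{{_ : NonZero n}} {E : Pred (Config n) 0ℓ} → Decidable E → RationalFunction (suc n)
Pr Λ n E? = Σᵣ (map (π Λ n) (filter E? (TAZRP Λ n)))

FirstSites : ∀ {ℓ n} → ℓ ≤ n → Vec Multiset ℓ → Config n → Set
FirstSites ℓ≤n u w = ∀ i → lookup w (inject≤ i ℓ≤n) ↭ lookup u i

FirstSites? : ∀ {ℓ n} (ℓ≤n : ℓ ≤ n) (u : Vec Multiset ℓ) → Decidable (FirstSites ℓ≤n u)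
FirstSites? ℓ≤n u w = Fin.all? λ i → lookup w (inject≤ i ℓ≤n) ↭? lookup u i

{-# OPTIONS --safe #-}
module Submission where

-- Since 𝒬(a,b,c) holds exactly when [b<c] + [c<a] − [b<a] = 1, quinv(σ) is the sum over pairs
-- of cells u, v of e(u,v)[σ(u)<σ(v)], where e(u,v) is 1 if v lies in the row of u and to its
-- right, or one row higher and to the left; it is minus the arm of u if v lies right above u.
--
-- Let p and q = p + 1 be letters beyond ℓ and fix the cells holding other letters. Up to a
-- common factor, what remains is a sum over words in p and q on the other cells, and the claim
-- is that it is symmetric in x_p and x_q. Let u be the first cell in the reading order and w
-- the last one with e(u,w) ≠ 0. Replacing e(u,w) by 0 affects only the words with p at u and q
-- at w. As e(u,v) = e(v,w) for all v between u and w, the contribution of v to such a word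
-- does not depend on its letter, so these words sum up to a multiple of x_p x_q times the sum
-- over the words on the cells other than u and w. By induction all sums are symmetric, and
-- the permutations fixing 1, …, ℓ are generated by transpositions of neighbours beyond ℓ.

open import Algebra using (CommutativeSemiring)
open import Algebra.Definitions using (LeftCancellative)
import Algebra.Solver.Ring.NaturalCoefficients.Default as SemiringSolver
open import Data.Bool using (Bool; true; false; if_then_else_)
open import Data.List using (List; []; _∷_; _++_; _∷ʳ_; map; length; concatMap;
  cartesianProductWith)
open import Data.List.Membership.Propositional using (_∈_)
open import Data.List.Properties using (++-assoc; ++-identityʳ; map-++; length-++)
open import Data.List.Relation.Binary.Permutation.Propositional using (_↭_)
import Data.List.Relation.Binary.Permutation.Propositional as ↭
open import Data.List.Relation.Binary.Pointwise using ([]; _∷_)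
import Data.List.Relation.Binary.Pointwise as Pointwise
open import Data.List.Relation.Unary.All using (All; []; _∷_)
import Data.List.Relation.Unary.All as All
import Data.List.Relation.Unary.All.Properties as All
open import Data.List.Relation.Unary.AllPairs using (AllPairs; []; _∷_)
open import Data.List.Relation.Unary.Any using (here; there)
open import Data.List.Relation.Unary.Unique.Propositional using (Unique)
open import Data.List.Reverse using (Reverse; []; _∶_∶ʳ_; reverseView)
open import Data.Nat using (ℕ; zero; suc; s≤s)
import Data.Nat as ℕ
import Data.Nat.Properties as ℕ
open import Data.Product using (∃-syntax; _×_; _,_; proj₁; proj₂)
open import Data.Sum using (_⊎_; inj₁; inj₂)
open import Data.Unit using (⊤)
open import Data.Vec using (Vec; []; _∷_; toList)
open import Data.Vec.Relation.Binary.Pointwise.Inductive using ([]; _∷_)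
import Data.Vec.Relation.Binary.Pointwise.Inductive as VecPointwise
open import Defs using (vecs)
open import Function using (_∘_)
open import Relation.Binary.PropositionalEquality using (_≡_; _≢_)
import Relation.Binary.PropositionalEquality as ≡

-- The computation takes place in ℕ[M], where M consists of the monomials in x₁, ..., xₙ and in t
-- and its inverse. Negative powers of t arise because a vertical pair carries minus an arm,
-- although a whole filling has the exponent `quinv σ` ≥ 0. As ℕ[M] has no subtraction, removing a
-- bond relies on addition being cancellative. Elements of ℕ[M] are lists up to `↭`, and this
-- relation survives every map of monomials, in particular the passage back to polynomial terms and
-- the renaming of variables. The event enters only through its invariance: whether the first ℓ
-- sites are as prescribed does not change when letters beyond ℓ are replaced by other letters
-- beyond ℓ. Hence the event is constant on each class of words obtained by fixing the cells with
-- letters other than p and q, and the two-letter symmetry applies class by class. The normalising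
-- sum is the case of the trivial event.

AllPairs-delete : ∀ {A : Set} {R : A → A → Set} as {w bs} → AllPairs R (as ++ w ∷ bs) →
  All (λ a → R a w) as × AllPairs R (as ++ bs)
AllPairs-delete []       (_ ∷ ps)  = [] , ps
AllPairs-delete (a ∷ as) (rs ∷ ps) with AllPairs-delete as ps | All.++⁻ as rs
... | qs , ps′ | rs₁ , r ∷ rs₂ = r ∷ qs , All.++⁺ rs₁ rs₂ ∷ ps′

-- Finite sums in a commutative semiring

module Sums {c ℓ} (S : CommutativeSemiring c ℓ) where

  open CommutativeSemiring S
  open SemiringSolver S

  Σ[_]_ : ∀ {X : Set} → List X → (X → Carrier) → Carrier
  Σ[ []     ] f = 0#
  Σ[ x ∷ xs ] f = f x + Σ[ xs ] f

  Σ-cong : ∀ {X : Set} {P : X → Set} {xs} → All P xs → ∀ {f g} → (∀ {x} → P x → f x ≈ g x) →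
    Σ[ xs ] f ≈ Σ[ xs ] g
  Σ-cong []       eq = refl
  Σ-cong (p ∷ ps) eq = +-cong (eq p) (Σ-cong ps eq)

  Σ-+ : ∀ {X : Set} (xs : List X) {f g} → Σ[ xs ] (λ x → f x + g x) ≈ Σ[ xs ] f + Σ[ xs ] g
  Σ-+ []       = sym (+-identityˡ 0#)
  Σ-+ (x ∷ xs) = trans (+-congˡ (Σ-+ xs))
    (solve 4 (λ a b c d → (a :+ b) :+ (c :+ d) := (a :+ c) :+ (b :+ d)) refl _ _ _ _)

  Σ-↭ : ∀ {X : Set} {xs ys : List X} {f} → xs ↭ ys → Σ[ xs ] f ≈ Σ[ ys ] f
  Σ-↭ ↭.refl         = refl
  Σ-↭ (↭.prep x p)   = +-congˡ (Σ-↭ p)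
  Σ-↭ (↭.swap x y p) = trans (+-congˡ (+-congˡ (Σ-↭ p)))
    (solve 3 (λ a b c → a :+ (b :+ c) := b :+ (a :+ c)) refl _ _ _)
  Σ-↭ (↭.trans p q)  = trans (Σ-↭ p) (Σ-↭ q)

  Σ-++ : ∀ {X : Set} (xs ys : List X) {f} → Σ[ xs ++ ys ] f ≈ Σ[ xs ] f + Σ[ ys ] f
  Σ-++ []       ys = sym (+-identityˡ _)
  Σ-++ (x ∷ xs) ys = trans (+-congˡ (Σ-++ xs ys)) (sym (+-assoc _ _ _))

  Σ-map : ∀ {X Y : Set} {h : X → Y} (xs : List X) {f} → Σ[ map h xs ] f ≡ Σ[ xs ] (f ∘ h)
  Σ-map []       = ≡.refl
  Σ-map (x ∷ xs) = ≡.cong (_ +_) (Σ-map xs)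

  Σ-cartesianProductWith : ∀ {X Y W : Set} {h : X → Y → W} (xs : List X) (ys : List Y) {f} →
    Σ[ cartesianProductWith h xs ys ] f ≈ Σ[ xs ] (λ x → Σ[ ys ] (f ∘ h x))
  Σ-cartesianProductWith []       ys = refl
  Σ-cartesianProductWith (x ∷ xs) ys = trans (Σ-++ (map _ ys) _)
    (+-cong (reflexive (Σ-map ys)) (Σ-cartesianProductWith xs ys))

  Σ-* : ∀ {X : Set} (xs : List X) c {f} → Σ[ xs ] (λ x → c * f x) ≈ c * Σ[ xs ] f
  Σ-* []       c = sym (zeroʳ c)
  Σ-* (x ∷ xs) c = trans (+-congˡ (Σ-* xs c)) (sym (distribˡ c _ _))

  Σ-zero : ∀ {X : Set} (xs : List X) → Σ[ xs ] (λ _ → 0#) ≈ 0#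
  Σ-zero []       = refl
  Σ-zero (x ∷ xs) = trans (+-identityˡ _) (Σ-zero xs)

  Σ-comm : ∀ {X Y : Set} (xs : List X) (ys : List Y) {f : X → Y → Carrier} →
    Σ[ xs ] (λ x → Σ[ ys ] f x) ≈ Σ[ ys ] (λ y → Σ[ xs ] (λ x → f x y))
  Σ-comm []       ys = sym (Σ-zero ys)
  Σ-comm (x ∷ xs) ys = trans (+-congˡ (Σ-comm xs ys)) (sym (Σ-+ ys))

  Σ-concatMap : ∀ {X Y : Set} {h : X → List Y} (xs : List X) {f} →
    Σ[ concatMap h xs ] f ≈ Σ[ xs ] (λ x → Σ[ h x ] f)
  Σ-concatMap           []       = refl
  Σ-concatMap {h = h} (x ∷ xs) = trans (Σ-++ (h x) _) (+-congˡ (Σ-concatMap xs))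

  Σ-cong′ : ∀ {X : Set} (xs : List X) {f g} → (∀ x → f x ≈ g x) → Σ[ xs ] f ≈ Σ[ xs ] g
  Σ-cong′ xs eq = Σ-cong {P = λ _ → ⊤} (All.universal _ xs) λ _ → eq _

  Σ-single : ∀ {X : Set} {xs : List X} {x} → Unique xs → x ∈ xs → ∀ {f} →
    (∀ y → y ≢ x → f y ≈ 0#) → Σ[ xs ] f ≈ f x
  Σ-single {xs = x ∷ xs} (x≢ ∷ _) (here ≡.refl) f≈0 = trans
    (+-congˡ (trans (Σ-cong x≢ λ x≢y → f≈0 _ (x≢y ∘ ≡.sym)) (Σ-zero xs))) (+-identityʳ _)
  Σ-single {xs = y ∷ xs} (y≢ ∷ u) (there x∈)    f≈0 = trans
    (+-cong (f≈0 _ (All.lookup y≢ x∈)) (Σ-single u x∈ f≈0)) (+-identityˡ _)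

-- Symmetry of the sum over words in two letters

module TwoLetters {c ℓ} (S : CommutativeSemiring c ℓ)
  (cancelˡ : LeftCancellative (CommutativeSemiring._≈_ S) (CommutativeSemiring._+_ S))
  {V : Set} (κ : V → V → CommutativeSemiring.Carrier S) (_◃_ : V → V → Set)
  (corners : ∀ v w → CommutativeSemiring._≈_ S (κ v w) (CommutativeSemiring.1# S) ⊎
    (∀ {a} → v ◃ a → a ◃ w → CommutativeSemiring._≈_ S (κ v a) (κ a w)))
  where

  open CommutativeSemiring S
  open SemiringSolver S
  open Sums S
  open import Relation.Binary.Reasoning.Setoid setoid

  -- Sum over all words in {0, 1} on a list of sites; a letter i contributes yᵢ, a letter 1
  -- at v contributes also its weight at v, and a 0 at v followed by a 1 at w gives κ v w.
  Z : Carrier → Carrier → (V → Carrier) → List (V × Carrier) → Carrier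
  Z y₀ y₁ c []            = 1#
  Z y₀ y₁ c ((v , g) ∷ r) =
    y₁ * (g * c v) * Z y₀ y₁ c r + y₀ * Z y₀ y₁ (λ w → c w * κ v w) r

  -- Only the product `g * c v` matters. It is kept as two factors because `V` has no decidable
  -- equality: `c` collects the bonds with all earlier letters 0, while `g`, stored at a position,
  -- lets weights be changed on a prefix of the list only.
  Z-cong : ∀ y₀ y₁ {c c′ r r′} →
    Pointwise.Pointwise (λ (v , g) (v′ , g′) → v ≡ v′ × g * c v ≈ g′ * c′ v) r r′ →
    Z y₀ y₁ c r ≈ Z y₀ y₁ c′ r′
  Z-cong y₀ y₁ []                          = refl
  Z-cong y₀ y₁ ((≡.refl , eq) ∷ eqs) =
    +-cong (*-cong (*-congˡ eq) (Z-cong y₀ y₁ eqs)) (*-congˡ (Z-cong y₀ y₁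
      (Pointwise.map
      (λ where (≡.refl , e) → ≡.refl ,
                 trans (sym (*-assoc _ _ _)) (trans (*-congʳ e) (*-assoc _ _ _))) eqs)))

  ones : List V → List (V × Carrier)
  ones = map (_, 1#)

  Πκ : V → List V → Carrier
  Πκ w []       = 1#
  Πκ w (a ∷ as) = κ a w * Πκ w as

  -- A site before w with letter i, weighted by h κ(a,w) if i = 1, contributes κ(a,w) times
  -- its weight hⁱ for either i as soon as w has letter 1.
  corner : ∀ y₀ y₁ w as bs c → ∃[ N ] ∀ g →
    Z y₀ y₁ c (map (λ (a , h) → a , h * κ a w) as ++ (w , g) ∷ bs)
      ≈ N + g * c w * (y₁ * Πκ w (map proj₁ as) * Z y₀ y₁ c (as ++ bs))
  corner y₀ y₁ w []             bs c = _ , λ g → solve 6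
    (λ y₀ y₁ g cw z z′ →
      y₁ :* (g :* cw) :* z :+ y₀ :* z′ := y₀ :* z′ :+ g :* cw :* (y₁ :* con 1 :* z))
    refl y₀ y₁ g (c w) _ _
  corner y₀ y₁ w ((a , h) ∷ as) bs c
    with corner y₀ y₁ w as bs c | corner y₀ y₁ w as bs (λ v → c v * κ a v)
  ... | N , eq | N′ , eq′ = _ , λ g → trans
    (+-cong (*-congˡ (eq g)) (*-congˡ (eq′ g)))
    (solve 12 (λ y₀ y₁ g h k ca cw N N′ Π z z′ →
      y₁ :* (h :* k :* ca) :* (N :+ g :* cw :* (y₁ :* Π :* z))
        :+ y₀ :* (N′ :+ g :* (cw :* k) :* (y₁ :* Π :* z′))
      := (y₁ :* (h :* k :* ca) :* N :+ y₀ :* N′)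
        :+ g :* cw :* (y₁ :* (k :* Π) :* (y₁ :* (h :* ca) :* z :+ y₀ :* z′)))
      refl y₀ y₁ g h (κ a w) (c a) (c w) N N′ (Πκ w (map proj₁ as)) _ _)

  module _ (y₀ y₁ : Carrier) where

    private
      Z₁ Z₂ : List (V × Carrier) → Carrier
      Z₁ = Z y₀ y₁ (λ _ → 1#)
      Z₂ = Z y₁ y₀ (λ _ → 1#)

    -- The induction is on a bound for the length, since it also needs the list with both the first
    -- site and a later site `w` deleted, which is not a tail.
    Z-sym : ∀ n vs → length vs ℕ.≤ n → AllPairs _◃_ vs → Z₁ (ones vs) ≈ Z₂ (ones vs)
    Z-sym _       []       _         _             = refl
    Z-sym (suc n) (v ∷ vs) (s≤s len) (v◃ ∷ sorted) = begin
      y₁ * (1# * 1#) * Z₁ (ones vs) + y₀ * Z y₀ y₁ (λ w → 1# * κ v w) (ones vs)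
        ≈⟨ +-cong (*-congʳ (one y₁)) (*-congˡ (Z-cong y₀ y₁ (full vs))) ⟩
      y₁ * Z₁ (ones vs) + y₀ * Z₁ (row vs [])
        ≈⟨ rows vs (reverseView vs) [] (≡.sym (++-identityʳ vs)) ⟩
      y₀ * Z₂ (ones vs) + y₁ * Z₂ (row vs [])
        ≈⟨ +-cong (*-congʳ (one y₀)) (*-congˡ (Z-cong y₁ y₀ (full vs))) ⟨
      y₀ * (1# * 1#) * Z₂ (ones vs) + y₁ * Z y₁ y₀ (λ w → 1# * κ v w) (ones vs) ∎
      where
      one : ∀ y → y * (1# * 1#) ≈ y
      one = solve 1 (λ y → y :* (con 1 :* con 1) := y) refl

      -- The weights that a letter 0 at `v` leaves on the other sites when `v` keeps its bonds with
      -- `as` and has lost those with `bs`.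
      row : List V → List V → List (V × Carrier)
      row as bs = map (λ a → a , κ v a) as ++ ones bs

      full : ∀ us → Pointwise.Pointwise
        (λ (u , g) (u′ , g′) → u ≡ u′ × g * (1# * κ v u) ≈ g′ * 1#) (ones us) (row us [])
      full []       = []
      full (u ∷ us) = (≡.refl , solve 1 (λ k → con 1 :* (con 1 :* k) := k :* con 1) refl _)
        ∷ full us

      open Pointwise using (++⁺)

      drop-w : ∀ as w bs → κ v w ≈ 1# → Pointwise.Pointwise
        (λ (u , g) (u′ , g′) → u ≡ u′ × g * 1# ≈ g′ * 1#) (row (as ∷ʳ w) bs) (row as (w ∷ bs))
      drop-w []       w bs eq = (≡.refl , *-congʳ eq) ∷ Pointwise.refl (≡.refl , refl)
      drop-w (a ∷ as) w bs eq = (≡.refl , refl) ∷ drop-w as w bs eq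

      -- The corner condition trades the bonds of `v` for bonds with `w`; this is the shape required
      -- by `corner`, with `h` equal to 1.
      split : ∀ as w bs → All (λ a → κ v a ≈ κ a w) as → ∀ g → Pointwise.Pointwise
        (λ (u , g) (u′ , g′) → u ≡ u′ × g * 1# ≈ g′ * 1#)
        (map (λ a → a , κ v a) as ++ (w , g) ∷ ones bs)
        (map (λ (a , h) → a , h * κ a w) (ones as) ++ (w , g) ∷ ones bs)
      split []       w bs []         g = Pointwise.refl (≡.refl , refl)
      split (a ∷ as) w bs (eq ∷ eqs) g =
        (≡.refl , *-congʳ (trans eq (sym (*-identityˡ _)))) ∷ split as w bs eqs g

      -- The term for letter 1 at `v` does not change when bonds of `v` are removed, but it is
      -- carried along because the symmetry concerns the sum over both letters at `v`.
      rows : ∀ as → Reverse as → ∀ bs → vs ≡ as ++ bs →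
        y₁ * Z₁ (ones vs) + y₀ * Z₁ (row as bs) ≈ y₀ * Z₂ (ones vs) + y₁ * Z₂ (row as bs)
      -- With no bond left, `v` contributes the symmetric factor y₀ + y₁.
      rows .[] [] bs ≡.refl = begin
        y₁ * Z₁ (ones vs) + y₀ * Z₁ (ones vs) ≈⟨ +-comm _ _ ⟩
        y₀ * Z₁ (ones vs) + y₁ * Z₁ (ones vs) ≈⟨ +-cong (*-congˡ IH) (*-congˡ IH) ⟩
        y₀ * Z₂ (ones vs) + y₁ * Z₂ (ones vs) ∎
        where IH = Z-sym n vs len sorted
      rows .(as ∷ʳ w) (as ∶ rs ∶ʳ w) bs ≡.refl
        with IH ← rows as rs (w ∷ bs) (++-assoc as (w ∷ []) bs) | corners v w
      ... | inj₁ κ≈1 = begin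
        y₁ * Z₁ (ones vs) + y₀ * Z₁ (row (as ∷ʳ w) bs)
          ≈⟨ +-congˡ (*-congˡ (Z-cong y₀ y₁ (drop-w as w bs κ≈1))) ⟩
        y₁ * Z₁ (ones vs) + y₀ * Z₁ (row as (w ∷ bs))
          ≈⟨ IH ⟩
        y₀ * Z₂ (ones vs) + y₁ * Z₂ (row as (w ∷ bs))
          ≈⟨ +-congˡ (*-congˡ (Z-cong y₁ y₀ (drop-w as w bs κ≈1))) ⟨
        y₀ * Z₂ (ones vs) + y₁ * Z₂ (row (as ∷ʳ w) bs) ∎
      ... | inj₂ κ≈κ = begin
        y₁ * Z₁ (ones vs) + y₀ * Z₁ (row (as ∷ʳ w) bs)
          ≈⟨ +-congˡ (*-congˡ (trans (reflexive (≡.cong Z₁ (row-∷ʳ as))) (expand₁ (κ v w)))) ⟩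
        y₁ * Z₁ (ones vs) + y₀ * (N₁ + κ v w * 1# * (y₁ * Π * Z₁ (ones as ++ ones bs)))
          ≈⟨ regroup _ _ _ _ _ _ _ ⟩
        (y₁ * Z₁ (ones vs) + y₀ * N₁) + κ v w * (y₀ * y₁ * Π * Z₁ (ones as ++ ones bs))
          ≈⟨ +-cong N₁≈N₂ (*-congˡ (*-congˡ IH₂)) ⟩
        (y₀ * Z₂ (ones vs) + y₁ * N₂) + κ v w * (y₀ * y₁ * Π * Z₂ (ones as ++ ones bs))
          ≈⟨ +-congˡ (*-congˡ (*-congʳ (*-congʳ (*-comm y₀ y₁)))) ⟩
        (y₀ * Z₂ (ones vs) + y₁ * N₂) + κ v w * (y₁ * y₀ * Π * Z₂ (ones as ++ ones bs))
          ≈⟨ regroup _ _ _ _ _ _ _ ⟨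
        y₀ * Z₂ (ones vs) + y₁ * (N₂ + κ v w * 1# * (y₀ * Π * Z₂ (ones as ++ ones bs)))
          ≈⟨ +-congˡ (*-congˡ (trans (reflexive (≡.cong Z₂ (row-∷ʳ as))) (expand₂ (κ v w)))) ⟨
        y₀ * Z₂ (ones vs) + y₁ * Z₂ (row (as ∷ʳ w) bs) ∎
        where
        deleted = AllPairs-delete as (≡.subst (AllPairs _◃_) (++-assoc as (w ∷ []) bs) sorted)
        eqs : All (λ a → κ v a ≈ κ a w) as
        eqs = All.zipWith (λ (p , q) → κ≈κ p q)
          (All.++⁻ˡ as (All.++⁻ˡ (as ∷ʳ w) v◃) , proj₁ deleted)

        row-∷ʳ : ∀ as → row (as ∷ʳ w) bs ≡ map (λ a → a , κ v a) as ++ (w , κ v w) ∷ ones bs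
        row-∷ʳ []       = ≡.refl
        row-∷ʳ (a ∷ as) = ≡.cong (_ ∷_) (row-∷ʳ as)

        Π  = Πκ w (map proj₁ (ones as))
        -- In `corner` the constant is chosen before the weight `g` of `w`, so the same `N₁` and
        -- `N₂` serve for `κ v w` in the goal and for 1 in the induction hypothesis.
        N₁ = proj₁ (corner y₀ y₁ w (ones as) (ones bs) (λ _ → 1#))
        N₂ = proj₁ (corner y₁ y₀ w (ones as) (ones bs) (λ _ → 1#))

        expand₁ : ∀ g → Z₁ (map (λ a → a , κ v a) as ++ (w , g) ∷ ones bs)
          ≈ N₁ + g * 1# * (y₁ * Π * Z₁ (ones as ++ ones bs))
        expand₁ g = trans (Z-cong y₀ y₁ (split as w bs eqs g))
          (proj₂ (corner y₀ y₁ w (ones as) (ones bs) (λ _ → 1#)) g)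

        expand₂ : ∀ g → Z₂ (map (λ a → a , κ v a) as ++ (w , g) ∷ ones bs)
          ≈ N₂ + g * 1# * (y₀ * Π * Z₂ (ones as ++ ones bs))
        expand₂ g = trans (Z-cong y₁ y₀ (split as w bs eqs g))
          (proj₂ (corner y₁ y₀ w (ones as) (ones bs) (λ _ → 1#)) g)

        regroup : ∀ y₀ y₁ z N k Π z′ → y₁ * z + y₀ * (N + k * 1# * (y₁ * Π * z′))
          ≈ (y₁ * z + y₀ * N) + k * (y₀ * y₁ * Π * z′)
        regroup = solve 7 (λ y₀ y₁ z N k Π z′ →
          y₁ :* z :+ y₀ :* (N :+ k :* con 1 :* (y₁ :* Π :* z′))
          := (y₁ :* z :+ y₀ :* N) :+ k :* (y₀ :* y₁ :* Π :* z′)) refl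

        shorter : length (as ++ bs) ℕ.≤ n
        shorter = ℕ.≤-trans (≡.subst₂ ℕ._≤_ (≡.sym (length-++ as))
          (≡.sym (≡.trans (≡.cong length (++-assoc as (w ∷ []) bs)) (length-++ as)))
          (ℕ.+-monoʳ-≤ (length as) (ℕ.n≤1+n (length bs)))) len

        IH₂ : Z₁ (ones as ++ ones bs) ≈ Z₂ (ones as ++ ones bs)
        IH₂ = ≡.subst (λ r → Z₁ r ≈ Z₂ r) (map-++ (_, 1#) as bs)
          (Z-sym n (as ++ bs) shorter (proj₂ deleted))

        -- `IH` is this equation with the corner term for weight 1 added on each side. The two
        -- corner terms agree by `IH₂`, and cancelling them takes the place of a subtraction.
        N₁≈N₂ : y₁ * Z₁ (ones vs) + y₀ * N₁ ≈ y₀ * Z₂ (ones vs) + y₁ * N₂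
        N₁≈N₂ = cancelˡ (1# * (y₀ * y₁ * Π * Z₁ (ones as ++ ones bs))) _ _ (begin
          1# * (y₀ * y₁ * Π * Z₁ (ones as ++ ones bs)) + (y₁ * Z₁ (ones vs) + y₀ * N₁)
            ≈⟨ trans (+-comm _ _) (sym (regroup _ _ _ _ _ _ _)) ⟩
          y₁ * Z₁ (ones vs) + y₀ * (N₁ + 1# * 1# * (y₁ * Π * Z₁ (ones as ++ ones bs)))
            ≈⟨ +-congˡ (*-congˡ (expand₁ 1#)) ⟨
          y₁ * Z₁ (ones vs) + y₀ * Z₁ (row as (w ∷ bs))
            ≈⟨ IH ⟩
          y₀ * Z₂ (ones vs) + y₁ * Z₂ (row as (w ∷ bs))
            ≈⟨ +-congˡ (*-congˡ (expand₂ 1#)) ⟩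
          y₀ * Z₂ (ones vs) + y₁ * (N₂ + 1# * 1# * (y₀ * Π * Z₂ (ones as ++ ones bs)))
            ≈⟨ trans (regroup _ _ _ _ _ _ _) (+-comm _ _) ⟩
          1# * (y₁ * y₀ * Π * Z₂ (ones as ++ ones bs)) + (y₀ * Z₂ (ones vs) + y₁ * N₂)
            ≈⟨ +-congʳ (*-congˡ (*-cong (*-congʳ (*-comm y₁ y₀)) (sym IH₂))) ⟩
          1# * (y₀ * y₁ * Π * Z₁ (ones as ++ ones bs)) + (y₀ * Z₂ (ones vs) + y₁ * N₂) ∎)

  -- From words in an ordered alphabet to words in two adjacent letters

  module Words {A : Set} (_<?_ : A → A → Bool) (p q : A)
    (p<p : p <? p ≡ false) (p<q : p <? q ≡ true)
    (q<p : q <? p ≡ false) (q<q : q <? q ≡ false)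
    (<-adjacentˡ : ∀ {o} → o ≢ p → o ≢ q → p <? o ≡ q <? o)
    (<-adjacentʳ : ∀ {o} → o ≢ p → o ≢ q → o <? p ≡ o <? q)
    where

    factor : V → V → A → A → Carrier
    factor v u a b = if a <? b then κ v u else 1#

    interaction : ∀ {n} → V → A → Vec V n → Vec A n → Carrier
    interaction v a []       []      = 1#
    interaction v a (u ∷ us) (b ∷ w) = factor v u a b * interaction v a us w

    weight : (A → Carrier) → ∀ {n} → Vec V n → Vec A n → Carrier
    weight x []       []      = 1#
    weight x (v ∷ vs) (a ∷ w) = x a * (interaction v a vs w * weight x vs w)

    -- A vector of entries is a class of words: the letters other than p and q are prescribed with
    -- their places, and each remaining place may hold p or q. These classes partition all words.
    data Entry : Set where
      fixed : ∀ o → o ≢ p → o ≢ q → Entry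
      free  : Entry

    data Fits : Entry → A → Set where
      fits-fixed : ∀ {o o≢p o≢q} → Fits (fixed o o≢p o≢q) o
      fits-p     : Fits free p
      fits-q     : Fits free q

    ΣFits : ∀ {n} → Vec Entry n → (Vec A n → Carrier) → Carrier
    ΣFits []                F = F []
    ΣFits (fixed o _ _ ∷ s) F = ΣFits s (F ∘ (o ∷_))
    ΣFits (free ∷ s)        F = ΣFits s (λ w → F (p ∷ w) + F (q ∷ w))

    ΣFits-cong : ∀ {n} (s : Vec Entry n) {F G} →
      (∀ {w} → VecPointwise.Pointwise Fits s w → F w ≈ G w) → ΣFits s F ≈ ΣFits s G
    ΣFits-cong []                eq = eq []
    ΣFits-cong (fixed o _ _ ∷ s) eq = ΣFits-cong s λ fs → eq (fits-fixed ∷ fs)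
    ΣFits-cong (free ∷ s)        eq =
      ΣFits-cong s λ fs → +-cong (eq (fits-p ∷ fs)) (eq (fits-q ∷ fs))

    ΣFits-+ : ∀ {n} (s : Vec Entry n) F G →
      ΣFits s (λ w → F w + G w) ≈ ΣFits s F + ΣFits s G
    ΣFits-+ []                F G = refl
    ΣFits-+ (fixed o _ _ ∷ s) F G = ΣFits-+ s _ _
    ΣFits-+ (free ∷ s)        F G = trans
      (ΣFits-cong s λ _ → solve 4 (λ a b c d → (a :+ b) :+ (c :+ d) := (a :+ c) :+ (b :+ d))
        refl _ _ _ _)
      (ΣFits-+ s _ _)

    ΣFits-* : ∀ {n} (s : Vec Entry n) c F → ΣFits s (λ w → c * F w) ≈ c * ΣFits s F
    ΣFits-* []                c F = refl
    ΣFits-* (fixed o _ _ ∷ s) c F = ΣFits-* s c _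
    ΣFits-* (free ∷ s)        c F =
      trans (ΣFits-cong s λ _ → sym (distribˡ c _ _)) (ΣFits-* s c _)

    -- The counterpart of the argument `c` of `Z`: a factor `c v` for each free site with letter q.
    -- On free sites `p <? a` recognises q.
    weight-q : ∀ {n} → (V → Carrier) → Vec V n → Vec Entry n → Vec A n → Carrier
    weight-q c []       []                []      = 1#
    weight-q c (v ∷ vs) (fixed _ _ _ ∷ s) (_ ∷ w) = weight-q c vs s w
    weight-q c (v ∷ vs) (free ∷ s)        (a ∷ w) =
      (if p <? a then c v else 1#) * weight-q c vs s w

    freeSites : ∀ {n} → Vec V n → Vec Entry n → List V
    freeSites []       []                = []
    freeSites (v ∷ vs) (fixed _ _ _ ∷ s) = freeSites vs s
    freeSites (v ∷ vs) (free ∷ s)        = v ∷ freeSites vs s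

    freeSites-All : ∀ {P : V → Set} {n} (vs : Vec V n) s → All P (toList vs) →
      All P (freeSites vs s)
    freeSites-All []       []                []       = []
    freeSites-All (v ∷ vs) (fixed _ _ _ ∷ s) (_ ∷ ps) = freeSites-All vs s ps
    freeSites-All (v ∷ vs) (free ∷ s)        (p ∷ ps) = p ∷ freeSites-All vs s ps

    freeSites-AllPairs : ∀ {n} (vs : Vec V n) s → AllPairs _◃_ (toList vs) →
      AllPairs _◃_ (freeSites vs s)
    freeSites-AllPairs []       []                []       = []
    freeSites-AllPairs (v ∷ vs) (fixed _ _ _ ∷ s) (_ ∷ ps) = freeSites-AllPairs vs s ps
    freeSites-AllPairs (v ∷ vs) (free ∷ s)        (r ∷ ps) =
      freeSites-All vs s r ∷ freeSites-AllPairs vs s ps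

    -- Free letters are read as p. For a letter `a` other than p and q this choice does not matter
    -- by adjacency; for `a` equal to p it makes their factors 1.
    fixedInteraction : ∀ {n} → V → A → Vec V n → Vec Entry n → Carrier
    fixedInteraction v a []       []                = 1#
    fixedInteraction v a (u ∷ us) (fixed o _ _ ∷ s) =
      factor v u a o * fixedInteraction v a us s
    fixedInteraction v a (u ∷ us) (free ∷ s)        =
      factor v u a p * fixedInteraction v a us s

    factor-cong : ∀ v u {b b′} → b ≡ b′ → (if b then κ v u else 1#) ≈ (if b′ then κ v u else 1#)
    factor-cong v u ≡.refl = refl

    interaction-fixed : ∀ {n} v {o} → o ≢ p → o ≢ q → (us : Vec V n) (s : Vec Entry n) →
      ∀ {w} → VecPointwise.Pointwise Fits s w →
      interaction v o us w ≈ fixedInteraction v o us s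
    interaction-fixed v o≢p o≢q []       _ []                = refl
    interaction-fixed v o≢p o≢q (u ∷ us) _ (fits-fixed ∷ fs) =
      *-congˡ (interaction-fixed v o≢p o≢q us _ fs)
    interaction-fixed v o≢p o≢q (u ∷ us) _ (fits-p ∷ fs)     =
      *-congˡ (interaction-fixed v o≢p o≢q us _ fs)
    interaction-fixed v o≢p o≢q (u ∷ us) _ (fits-q ∷ fs)     =
      *-cong (factor-cong v u (≡.sym (<-adjacentʳ o≢p o≢q))) (interaction-fixed v o≢p o≢q us _ fs)

    -- A q is smaller than neither p nor q, so it has trivial factors with the free letters; with
    -- the prescribed ones it behaves like p by adjacency.
    interaction-q : ∀ {n} v (us : Vec V n) (s : Vec Entry n) →
      ∀ {w} → VecPointwise.Pointwise Fits s w →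
      interaction v q us w ≈ fixedInteraction v p us s
    interaction-q v []       _ []                = refl
    interaction-q v (u ∷ us) _ (fits-fixed {o≢p = o≢p} {o≢q} ∷ fs) =
      *-cong (factor-cong v u (≡.sym (<-adjacentˡ o≢p o≢q))) (interaction-q v us _ fs)
    interaction-q v (u ∷ us) _ (fits-p ∷ fs)     =
      *-cong (factor-cong v u (≡.trans q<p (≡.sym p<p))) (interaction-q v us _ fs)
    interaction-q v (u ∷ us) _ (fits-q ∷ fs)     =
      *-cong (factor-cong v u (≡.trans q<q (≡.sym p<p))) (interaction-q v us _ fs)

    if-p : ∀ a b → (if p <? p then a else b) ≈ b
    if-p a b = reflexive (≡.cong (λ t → if t then a else b) p<p)

    if-q : ∀ a b → (if p <? q then a else b) ≈ a
    if-q a b = reflexive (≡.cong (λ t → if t then a else b) p<q)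

    -- Among the free letters a p is smaller than q only. Its factors `κ v u` there are those gained
    -- by `weight-q` when `c` is multiplied by `κ v`, as in the recursion of `Z` for a letter 0.
    interaction-p : ∀ {n} v c (us : Vec V n) (s : Vec Entry n) →
      ∀ {w} → VecPointwise.Pointwise Fits s w →
      weight-q c us s w * interaction v p us w
        ≈ fixedInteraction v p us s * weight-q (λ u → c u * κ v u) us s w
    interaction-p v c []       _ []                = refl
    interaction-p v c (u ∷ us) _ (fits-fixed ∷ fs) = trans
      (solve 3 (λ a b c → a :* (b :* c) := b :* (a :* c)) refl _ _ _)
      (trans (*-congˡ (interaction-p v c us _ fs)) (sym (*-assoc _ _ _)))
    interaction-p v c (u ∷ us) _ (fits-p ∷ fs)     = trans
      (*-cong (*-congʳ (if-p _ _)) (*-congʳ (if-p _ _))) (trans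
      (solve 2 (λ a b → (con 1 :* a) :* (con 1 :* b) := a :* b) refl _ _) (trans
      (interaction-p v c us _ fs) (trans
      (solve 2 (λ a b → a :* b := (con 1 :* a) :* (con 1 :* b)) refl _ _)
      (sym (*-cong (*-congʳ (if-p _ _)) (*-congʳ (if-p _ _)))))))
    interaction-p v c (u ∷ us) _ (fits-q ∷ fs)     = trans
      (*-cong (*-congʳ (if-q _ _)) (*-congʳ (if-q _ _))) (trans
      (solve 4 (λ a b c d → (a :* b) :* (c :* d) := (a :* c) :* (b :* d)) refl _ _ _ _) (trans
      (*-congˡ (interaction-p v c us _ fs)) (trans
      (solve 3 (λ a b c → a :* (b :* c) := (con 1 :* b) :* (a :* c)) refl _ _ _)
      (sym (*-cong (*-congʳ (if-p _ _)) (*-congʳ (if-q _ _)))))))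

    prefactor : (A → Carrier) → ∀ {n} → Vec V n → Vec Entry n → Carrier
    prefactor x []       []                = 1#
    prefactor x (v ∷ vs) (fixed o _ _ ∷ s) =
      x o * fixedInteraction v o vs s * prefactor x vs s
    prefactor x (v ∷ vs) (free ∷ s)        = fixedInteraction v p vs s * prefactor x vs s

    -- General `c` is needed because a p at the first free site changes `c` for the later ones. All
    -- dependence on `x p` and `x q` is confined to `Z`.
    ΣFits-weight : ∀ x c {n} (vs : Vec V n) s →
      ΣFits s (λ w → weight-q c vs s w * weight x vs w)
        ≈ prefactor x vs s * Z (x p) (x q) c (ones (freeSites vs s))
    ΣFits-weight x c []       []                      = refl
    ΣFits-weight x c (v ∷ vs) (fixed o o≢p o≢q ∷ s) = begin
      ΣFits s (λ w → weight-q c vs s w * (x o * (interaction v o vs w * weight x vs w)))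
        ≈⟨ ΣFits-cong s (λ fs → trans
             (*-congˡ (*-congˡ (*-congʳ (interaction-fixed v o≢p o≢q vs s fs))))
             (solve 4 (λ a b c d → a :* (b :* (c :* d)) := (b :* c) :* (a :* d)) refl _ _ _ _)) ⟩
      ΣFits s (λ w → x o * fixedInteraction v o vs s * (weight-q c vs s w * weight x vs w))
        ≈⟨ ΣFits-* s _ _ ⟩
      x o * fixedInteraction v o vs s * ΣFits s (λ w → weight-q c vs s w * weight x vs w)
        ≈⟨ *-congˡ (ΣFits-weight x c vs s) ⟩
      x o * fixedInteraction v o vs s * (prefactor x vs s * Z (x p) (x q) c (ones (freeSites vs s)))
        ≈⟨ *-assoc _ _ _ ⟨
      prefactor x (v ∷ vs) (fixed o o≢p o≢q ∷ s) * Z (x p) (x q) c (ones (freeSites vs s)) ∎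
    ΣFits-weight x c (v ∷ vs) (free ∷ s)            = begin
      ΣFits s (λ w →
        weight-q c (v ∷ vs) (free ∷ s) (p ∷ w) * (x p * (interaction v p vs w * weight x vs w)) +
        weight-q c (v ∷ vs) (free ∷ s) (q ∷ w) * (x q * (interaction v q vs w * weight x vs w)))
        ≈⟨ ΣFits-cong s (λ fs → +-cong (with-p fs) (with-q fs)) ⟩
      ΣFits s (λ w → J * x p * (weight-q (λ u → c u * κ v u) vs s w * weight x vs w) +
        J * (x q * c v) * (weight-q c vs s w * weight x vs w))
        ≈⟨ trans (ΣFits-+ s _ _) (+-cong (ΣFits-* s _ _) (ΣFits-* s _ _)) ⟩
      J * x p * ΣFits s (λ w → weight-q (λ u → c u * κ v u) vs s w * weight x vs w) +
        J * (x q * c v) * ΣFits s (λ w → weight-q c vs s w * weight x vs w)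
        ≈⟨ +-cong (*-congˡ (ΣFits-weight x _ vs s)) (*-congˡ (ΣFits-weight x c vs s)) ⟩
      J * x p * (prefactor x vs s * Z (x p) (x q) (λ u → c u * κ v u) (ones (freeSites vs s))) +
        J * (x q * c v) * (prefactor x vs s * Z (x p) (x q) c (ones (freeSites vs s)))
        ≈⟨ solve 7 (λ J y₀ y₁ c P z z′ → J :* y₀ :* (P :* z′) :+ J :* (y₁ :* c) :* (P :* z)
             := (J :* P) :* (y₁ :* (con 1 :* c) :* z :+ y₀ :* z′)) refl _ _ _ _ _ _ _ ⟩
      prefactor x (v ∷ vs) (free ∷ s) * Z (x p) (x q) c (ones (freeSites (v ∷ vs) (free ∷ s))) ∎
      where
      J = fixedInteraction v p vs s

      with-p : ∀ {w} → VecPointwise.Pointwise Fits s w →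
        (if p <? p then c v else 1#) * weight-q c vs s w *
          (x p * (interaction v p vs w * weight x vs w))
          ≈ J * x p * (weight-q (λ u → c u * κ v u) vs s w * weight x vs w)
      with-p fs = trans (*-congʳ (*-congʳ (if-p _ _))) (trans
        (solve 4 (λ a b c d → con 1 :* a :* (b :* (c :* d)) := (a :* c) :* (b :* d))
          refl _ _ _ _) (trans
        (*-congʳ (interaction-p v c vs s fs))
          (solve 4 (λ a b c d → (a :* b) :* (c :* d) := a :* c :* (b :* d)) refl _ _ _ _)))

      with-q : ∀ {w} → VecPointwise.Pointwise Fits s w →
        (if p <? q then c v else 1#) * weight-q c vs s w *
          (x q * (interaction v q vs w * weight x vs w))
          ≈ J * (x q * c v) * (weight-q c vs s w * weight x vs w)
      with-q fs = trans
        (*-cong (*-congʳ (if-q _ _)) (*-congˡ (*-congʳ (interaction-q v vs s fs))))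
        (solve 5 (λ a b c d e → a :* b :* (c :* (d :* e)) := d :* (c :* a) :* (b :* e))
          refl _ _ _ _ _)

    weight-q-1 : ∀ {n} (vs : Vec V n) s {w} → VecPointwise.Pointwise Fits s w →
      weight-q (λ _ → 1#) vs s w ≈ 1#
    weight-q-1 []       _ []                = refl
    weight-q-1 (v ∷ vs) _ (fits-fixed ∷ fs) = weight-q-1 vs _ fs
    weight-q-1 (v ∷ vs) _ (fits-p ∷ fs)     =
      trans (trans (*-congʳ (if-p _ _)) (*-identityˡ _)) (weight-q-1 vs _ fs)
    weight-q-1 (v ∷ vs) _ (fits-q ∷ fs)     =
      trans (trans (*-congʳ (if-q _ _)) (*-identityˡ _)) (weight-q-1 vs _ fs)

    -- Splitting the alphabet into {p, q} and single letters at each position decomposes the sum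
    -- over all words into sums over classes.
    Σ-vecs-cong : ∀ {as os} → as ↭ p ∷ q ∷ os → All (λ o → o ≢ p × o ≢ q) os →
      ∀ {n} {F G : Vec A n → Carrier} →
      (∀ s → ΣFits s F ≈ ΣFits s G) → Σ[ vecs as n ] F ≈ Σ[ vecs as n ] G
    Σ-vecs-cong as↭ os≢ {zero}          F≈G = +-congʳ (F≈G [])
    Σ-vecs-cong {as} {os} as↭ os≢ {suc n} {F} {G} F≈G = begin
      Σ[ vecs as (suc n) ] F
        ≈⟨ regroup F ⟩
      Σ[ vecs as n ] (λ w → F (p ∷ w) + F (q ∷ w)) +
        Σ[ os ] (λ o → Σ[ vecs as n ] (F ∘ (o ∷_)))
        ≈⟨ +-cong (Σ-vecs-cong as↭ os≢ (F≈G ∘ (free ∷_)))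
             (Σ-cong os≢ λ (o≢p , o≢q) → Σ-vecs-cong as↭ os≢ (F≈G ∘ (fixed _ o≢p o≢q ∷_))) ⟩
      Σ[ vecs as n ] (λ w → G (p ∷ w) + G (q ∷ w)) +
        Σ[ os ] (λ o → Σ[ vecs as n ] (G ∘ (o ∷_)))
        ≈⟨ regroup G ⟨
      Σ[ vecs as (suc n) ] G ∎
      where
      regroup : ∀ F → Σ[ vecs as (suc n) ] F ≈
        Σ[ vecs as n ] (λ w → F (p ∷ w) + F (q ∷ w)) +
        Σ[ os ] (λ o → Σ[ vecs as n ] (F ∘ (o ∷_)))
      regroup F = trans (Σ-cartesianProductWith as (vecs as n)) (trans (Σ-↭ as↭)
        (trans (sym (+-assoc _ _ _)) (+-congʳ (sym (Σ-+ (vecs as n))))))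

    word : ∀ {n} → Vec Entry n → Vec A n
    word []                = []
    word (fixed o _ _ ∷ s) = o ∷ word s
    word (free ∷ s)        = p ∷ word s

    word-fits : ∀ {n} (s : Vec Entry n) → VecPointwise.Pointwise Fits s (word s)
    word-fits []                = []
    word-fits (fixed o _ _ ∷ s) = fits-fixed ∷ word-fits s
    word-fits (free ∷ s)        = fits-p ∷ word-fits s

    module _ {x x′ : A → Carrier} (x′p : x′ p ≡ x q) (x′q : x′ q ≡ x p)
      (x′o : ∀ {o} → o ≢ p → o ≢ q → x′ o ≡ x o) where

      prefactor-swap : ∀ {n} (vs : Vec V n) s → prefactor x vs s ≈ prefactor x′ vs s
      prefactor-swap []       []                      = refl
      prefactor-swap (v ∷ vs) (fixed o o≢p o≢q ∷ s) =
        *-cong (*-congʳ (sym (reflexive (x′o o≢p o≢q)))) (prefactor-swap vs s)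
      prefactor-swap (v ∷ vs) (free ∷ s)            = *-congˡ (prefactor-swap vs s)

      ΣFits-swap : ∀ {n} (vs : Vec V n) s → AllPairs _◃_ (toList vs) →
        ΣFits s (weight x vs) ≈ ΣFits s (weight x′ vs)
      ΣFits-swap vs s sorted = begin
        ΣFits s (weight x vs)
          ≈⟨ ΣFits-cong s (λ fs → trans (*-congʳ (weight-q-1 vs s fs)) (*-identityˡ _)) ⟨
        ΣFits s (λ w → weight-q (λ _ → 1#) vs s w * weight x vs w)
          ≈⟨ ΣFits-weight x _ vs s ⟩
        prefactor x vs s * Z (x p) (x q) (λ _ → 1#) (ones (freeSites vs s))
          ≈⟨ *-cong (prefactor-swap vs s)
               (Z-sym (x p) (x q) _ _ ℕ.≤-refl (freeSites-AllPairs vs s sorted)) ⟩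
        prefactor x′ vs s * Z (x q) (x p) (λ _ → 1#) (ones (freeSites vs s))
          ≡⟨ ≡.cong₂ (λ y₀ y₁ → prefactor x′ vs s * Z y₀ y₁ (λ _ → 1#) (ones (freeSites vs s)))
               x′p x′q ⟨
        prefactor x′ vs s * Z (x′ p) (x′ q) (λ _ → 1#) (ones (freeSites vs s))
          ≈⟨ ΣFits-weight x′ _ vs s ⟨
        ΣFits s (λ w → weight-q (λ _ → 1#) vs s w * weight x′ vs w)
          ≈⟨ ΣFits-cong s (λ fs → trans (*-congʳ (weight-q-1 vs s fs)) (*-identityˡ _)) ⟩
        ΣFits s (weight x′ vs) ∎

      -- As `b` is constant on each class, its value at the representative `word s` can be taken out
      -- of the sum over the class.
      Σ-words-swap : ∀ {n} (vs : Vec V n) → AllPairs _◃_ (toList vs) →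
        (b : Vec A n → Bool) →
        (∀ {s w w′} → VecPointwise.Pointwise Fits s w → VecPointwise.Pointwise Fits s w′ →
          b w ≡ b w′) →
        ∀ {as os} → as ↭ p ∷ q ∷ os → All (λ o → o ≢ p × o ≢ q) os →
        Σ[ vecs as n ] (λ w → if b w then weight x vs w else 0#)
          ≈ Σ[ vecs as n ] (λ w → if b w then weight x′ vs w else 0#)
      Σ-words-swap vs sorted b b-resp as↭ os≢ = Σ-vecs-cong as↭ os≢ λ s →
        trans (restrict s x) (trans
          (if-cong (b (word s)) (ΣFits-swap vs s sorted))
          (sym (restrict s x′)))
        where
        if-cong : ∀ t {y z} → y ≈ z → (if t then y else 0#) ≈ (if t then z else 0#)
        if-cong true  eq = eq
        if-cong false eq = refl

        restrict : ∀ s x → ΣFits s (λ w → if b w then weight x vs w else 0#)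
          ≈ (if b (word s) then ΣFits s (weight x vs) else 0#)
        restrict s x = trans
          (ΣFits-cong s λ fs → reflexive (≡.cong (λ t → if t then weight x vs _ else 0#)
            (b-resp fs (word-fits s))))
          (pull (b (word s)))
          where
          pull : ∀ t → ΣFits s (λ w → if t then weight x vs w else 0#)
            ≈ (if t then ΣFits s (weight x vs) else 0#)
          pull true  = refl
          pull false = trans (ΣFits-cong s λ _ → sym (zeroˡ 0#)) (trans (ΣFits-* s 0# _) (zeroˡ _))

open import Algebra using (IsCommutativeMonoid; CommutativeRing)
open import Algebra.Structures.Biased using (IsCommutativeSemiringˡ)
open import Data.Fin using (Fin; toℕ; inject≤)
import Data.Fin as Fin
open import Data.Fin.Permutation using (Permutation′; _⟨$⟩ʳ_; _⟨$⟩ˡ_; inverseˡ; inverseʳ; lift₀;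
  _∘ₚ_; transpose)
import Data.Fin.Permutation as Perm
import Data.Fin.Properties as Fin
open import Data.Integer using (ℤ; +_; 0ℤ; 1ℤ; -_; ∣_∣)
import Data.Integer as ℤ
import Data.Integer.Properties as ℤ
open import Data.Integer.Solver using (module +-*-Solver)
open import Data.List using (filter; allFin; cartesianProduct; concat)
import Data.List as List
open import Data.List.Membership.Propositional.Properties using (∈-map⁺; ∈-concat⁺′; ∈-allFin;
  ∈-map⁻; ∈-lookup; ∈-∃++)
open import Data.List.Membership.Propositional.Properties.WithK using (unique∧set⇒bag;
  unique⇒irrelevant)
open import Data.List.Properties using (cartesianProductWith-zeroʳ;
  cartesianProductWith-distribʳ-++; map-cong; map-∘; map-id; map-tabulate)
import Data.List.Properties as List
open import Data.List.Relation.Binary.BagAndSetEquality using (∼bag⇒↭)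
open import Data.List.Relation.Binary.Permutation.Propositional using (↭-refl; ↭-sym; ↭-trans;
  ↭-prep; ↭-reflexive; ↭-isEquivalence; module PermutationReasoning)
open import Data.List.Relation.Binary.Permutation.Propositional.Properties using (++⁺; ++⁺ˡ;
  shifts; map⁺; drop-∷; ++-isCommutativeMonoid; filter-↭; ∈-resp-↭; shift)
import Data.List.Relation.Binary.Permutation.Setoid.Properties as ↭ₛ
import Data.List.Relation.Unary.AllPairs as AllPairs
import Data.List.Relation.Unary.AllPairs.Properties as AllPairs
open import Data.List.Relation.Unary.Any using (Any; any?)
import Data.List.Relation.Unary.Any as Any
import Data.List.Relation.Unary.Any.Properties as Any
open import Data.List.Relation.Unary.Linked.Properties using (Linked⇒AllPairs)
import Data.List.Relation.Unary.Unique.Propositional.Properties as Unique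
import Data.List.Sort as Sort
open import Data.Nat using (_<_; _≤_; NonZero)
open import Data.Nat.Properties using (<⇒≤)
open import Data.Product.Relation.Binary.Lex.NonStrict using (×-decTotalOrder)
open import Data.Unit using (tt)
open import Data.Vec using (lookup; tabulate; replicate; fromList; _[_]≔_)
import Data.Vec as Vec
import Data.Vec.Properties as Vec
import Data.Vec.Relation.Unary.All as VecAll
open import Defs
open import Function using (id; mk⇔)
open import Level using (0ℓ)
open import Relation.Binary using (DecTotalOrder; DecSetoid)
import Relation.Binary.Construct.On as On
open import Relation.Binary.PropositionalEquality
open import Relation.Nullary using (Dec; yes; no; ¬_; ¬?; does; contradiction)
open import Relation.Nullary.Decidable using (_×-dec_; _⊎-dec_; dec-true; dec-false; does-⇔)
open import Relation.Unary using (Pred; Decidable)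

-- Finite multisets over a commutative monoid as a cancellative semiring

++-cancelˡ-↭ : ∀ {A : Set} (xs : List A) {ys zs} → xs ++ ys ↭ xs ++ zs → ys ↭ zs
++-cancelˡ-↭ []       p = p
++-cancelˡ-↭ (x ∷ xs) p = ++-cancelˡ-↭ xs (drop-∷ p)

-- The monoid semiring ℕ[M]: a sum of elements of M is a list up to ↭.
module MultisetSemiring {M : Set} {_∙_ : M → M → M} {ε : M}
  (isCM : IsCommutativeMonoid _≡_ _∙_ ε) where

  private module M = IsCommutativeMonoid isCM

  infixl 7 _⊛_
  _⊛_ : List M → List M → List M
  _⊛_ = cartesianProductWith _∙_

  open PermutationReasoning

  ⊛-congʳ : ∀ {xs ys} zs → xs ↭ ys → xs ⊛ zs ↭ ys ⊛ zs
  ⊛-congʳ zs ↭.refl         = ↭.refl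
  ⊛-congʳ zs (↭.prep x p)    = ++⁺ˡ (map (x ∙_) zs) (⊛-congʳ zs p)
  ⊛-congʳ zs (↭.swap x y p) = ↭-trans (shifts (map (x ∙_) zs) (map (y ∙_) zs))
    (++⁺ˡ (map (y ∙_) zs) (++⁺ˡ (map (x ∙_) zs) (⊛-congʳ zs p)))
  ⊛-congʳ zs (↭.trans p q)  = ↭-trans (⊛-congʳ zs p) (⊛-congʳ zs q)

  ⊛-congˡ : ∀ xs {ys zs} → ys ↭ zs → xs ⊛ ys ↭ xs ⊛ zs
  ⊛-congˡ []       p = ↭-refl
  ⊛-congˡ (x ∷ xs) p = ++⁺ (map⁺ (x ∙_) p) (⊛-congˡ xs p)

  ⊛-zeroʳ : ∀ xs → xs ⊛ [] ↭ []
  ⊛-zeroʳ xs = ↭-reflexive (cartesianProductWith-zeroʳ _∙_ xs)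

  ⊛-∷ʳ : ∀ xs y ys → xs ⊛ (y ∷ ys) ↭ map (y ∙_) xs ++ xs ⊛ ys
  ⊛-∷ʳ []       y ys = ↭-refl
  ⊛-∷ʳ (x ∷ xs) y ys = begin
    x ∙ y ∷ map (x ∙_) ys ++ xs ⊛ (y ∷ ys)
      ↭⟨ ↭-prep _ (++⁺ˡ (map (x ∙_) ys) (⊛-∷ʳ xs y ys)) ⟩
    x ∙ y ∷ map (x ∙_) ys ++ (map (y ∙_) xs ++ xs ⊛ ys)
      ↭⟨ ↭-prep _ (shifts (map (x ∙_) ys) (map (y ∙_) xs)) ⟩
    x ∙ y ∷ map (y ∙_) xs ++ (map (x ∙_) ys ++ xs ⊛ ys)
      ≡⟨ cong (_∷ map (y ∙_) xs ++ (map (x ∙_) ys ++ xs ⊛ ys)) (M.comm x y) ⟩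
    y ∙ x ∷ map (y ∙_) xs ++ (map (x ∙_) ys ++ xs ⊛ ys) ∎

  ⊛-comm : ∀ xs ys → xs ⊛ ys ↭ ys ⊛ xs
  ⊛-comm []       ys = ↭-sym (⊛-zeroʳ ys)
  ⊛-comm (x ∷ xs) ys = begin
    map (x ∙_) ys ++ xs ⊛ ys ↭⟨ ++⁺ˡ (map (x ∙_) ys) (⊛-comm xs ys) ⟩
    map (x ∙_) ys ++ ys ⊛ xs ↭⟨ ⊛-∷ʳ ys x xs ⟨
    ys ⊛ (x ∷ xs)            ∎

  map-⊛ : ∀ x ys zs → map (x ∙_) ys ⊛ zs ≡ map (x ∙_) (ys ⊛ zs)
  map-⊛ x []       zs = refl
  map-⊛ x (y ∷ ys) zs = trans
    (cong₂ _++_ (trans (map-cong (M.assoc x y) zs) (map-∘ zs)) (map-⊛ x ys zs))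
    (sym (map-++ (x ∙_) (map (y ∙_) zs) (ys ⊛ zs)))

  ⊛-assoc : ∀ xs ys zs → (xs ⊛ ys) ⊛ zs ↭ xs ⊛ (ys ⊛ zs)
  ⊛-assoc []       ys zs = ↭-refl
  ⊛-assoc (x ∷ xs) ys zs = begin
    (map (x ∙_) ys ++ xs ⊛ ys) ⊛ zs
      ≡⟨ cartesianProductWith-distribʳ-++ _∙_ (map (x ∙_) ys) (xs ⊛ ys) zs ⟩
    map (x ∙_) ys ⊛ zs ++ (xs ⊛ ys) ⊛ zs
      ≡⟨ cong (_++ (xs ⊛ ys) ⊛ zs) (map-⊛ x ys zs) ⟩
    map (x ∙_) (ys ⊛ zs) ++ (xs ⊛ ys) ⊛ zs
      ↭⟨ ++⁺ˡ (map (x ∙_) (ys ⊛ zs)) (⊛-assoc xs ys zs) ⟩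
    map (x ∙_) (ys ⊛ zs) ++ xs ⊛ (ys ⊛ zs) ∎

  ⊛-identityˡ : ∀ xs → (ε ∷ []) ⊛ xs ↭ xs
  ⊛-identityˡ xs = ↭-reflexive (trans (++-identityʳ (map (ε ∙_) xs))
    (trans (map-cong M.identityˡ xs) (map-id xs)))

  commutativeSemiring : CommutativeSemiring 0ℓ 0ℓ
  commutativeSemiring = record
    { Carrier = List M
    ; _≈_     = _↭_
    ; _+_     = _++_
    ; _*_     = _⊛_
    ; 0#      = []
    ; 1#      = ε ∷ []
    ; isCommutativeSemiring = IsCommutativeSemiringˡ.isCommutativeSemiring (record
      { +-isCommutativeMonoid = ++-isCommutativeMonoid
      ; *-isCommutativeMonoid = record
        { isMonoid = record
          { isSemigroup = record
            { isMagma = record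
              { isEquivalence = ↭-isEquivalence
              ; ∙-cong        = λ {x} {y} {u} {v} p q → ↭-trans (⊛-congʳ u p) (⊛-congˡ y q)
              }
            ; assoc = ⊛-assoc
            }
          ; identity = ⊛-identityˡ , λ xs → ↭-trans (⊛-comm xs _) (⊛-identityˡ xs)
          }
        ; comm = ⊛-comm
        }
      ; distribʳ = λ xs ys zs →
          ↭-reflexive (cartesianProductWith-distribʳ-++ _∙_ ys zs xs)
      ; zeroˡ    = λ _ → ↭-refl
      })
    }

  open Sums commutativeSemiring using (Σ[_]_)

  Σ-filter : ∀ {X Y : Set} {P : Pred Y 0ℓ} (P? : Decidable P) (h : X → Y) (g : Y → M)
    {f : X → List M} → (∀ x → f x ≡ g (h x) ∷ []) → ∀ xs →
    Σ[ xs ] (λ x → if does (P? (h x)) then f x else []) ≡ map g (filter P? (map h xs))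
  Σ-filter P? h g eq []       = refl
  Σ-filter P? h g eq (x ∷ xs) with does (P? (h x))
  ... | true  = cong₂ _++_ (eq x) (Σ-filter P? h g eq xs)
  ... | false = Σ-filter P? h g eq xs

-- Integer sums and Iverson brackets

open Sums (CommutativeRing.commutativeSemiring ℤ.+-*-commutativeRing)

⟦_⟧ : ∀ {P : Set} → Dec P → ℤ
⟦ d ⟧ = if does d then 1ℤ else 0ℤ

⟦⟧-yes : ∀ {P : Set} (d : Dec P) → P → ⟦ d ⟧ ≡ 1ℤ
⟦⟧-yes d p = cong (if_then 1ℤ else 0ℤ) (dec-true d p)

⟦⟧-no : ∀ {P : Set} (d : Dec P) → ¬ P → ⟦ d ⟧ ≡ 0ℤ
⟦⟧-no d ¬p = cong (if_then 1ℤ else 0ℤ) (dec-false d ¬p)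

⟦⟧-× : ∀ {P Q R : Set} (d : Dec P) (e : Dec Q) (f : Dec R) →
  ⟦ d ×-dec (e ×-dec f) ⟧ ≡ ⟦ d ×-dec e ⟧ ℤ.* ⟦ f ⟧
⟦⟧-× (yes _) (yes _) f = sym (ℤ.*-identityˡ ⟦ f ⟧)
⟦⟧-× (yes _) (no _)  f = refl
⟦⟧-× (no _)  e       f = refl

length-filter : ∀ {X : Set} {P : Pred X 0ℓ} (P? : Decidable P) xs →
  + length (filter P? xs) ≡ Σ[ xs ] (λ x → ⟦ P? x ⟧)
length-filter P? []       = refl
length-filter P? (x ∷ xs) with does (P? x)
... | true  = cong (ℤ._+_ 1ℤ) (length-filter P? xs)
... | false = trans (length-filter P? xs) (sym (ℤ.+-identityˡ _))

-- quinv as a sum over pairs of cells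

-- The convention `a` = 0 above the top of a column makes the last two brackets vanish, so such
-- pairs count as plain ascents from `b` to `c`.
𝒬-count : ∀ a b c → ⟦ 𝒬? a b c ⟧ ≡ ⟦ b ℕ.<? c ⟧ ℤ.+ ⟦ c ℕ.<? a ⟧ ℤ.- ⟦ b ℕ.<? a ⟧
𝒬-count a b c =
  go (a ℕ.<? b) (a ℕ.≟ b) (b ℕ.<? a) (b ℕ.<? c) (c ℕ.<? a) (b ℕ.≟ c)
  where
  go : (a<b : Dec (a < b)) (a≡b : Dec (a ≡ b)) (b<a : Dec (b < a)) (b<c : Dec (b < c))
    (c<a : Dec (c < a)) (b≡c : Dec (b ≡ c)) →
    ⟦ (a<b ×-dec b<c) ⊎-dec (b<c ×-dec c<a) ⊎-dec (c<a ×-dec a<b) ⊎-dec (a≡b ×-dec ¬? b≡c) ⟧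
      ≡ ⟦ b<c ⟧ ℤ.+ ⟦ c<a ⟧ ℤ.- ⟦ b<a ⟧
  go (yes p) (yes refl) _ _ _ _ = contradiction p (ℕ.<-irrefl refl)
  go (yes p) _ (yes q) _ _ _ = contradiction q (ℕ.<-asym p)
  go _ (yes refl) (yes p) _ _ _ = contradiction p (ℕ.<-irrefl refl)
  go (no p) (no q) (no r) _ _ _ = contradiction (ℕ.≤-antisym (ℕ.≮⇒≥ r) (ℕ.≮⇒≥ p)) q
  go (yes p) (no _) (no _) (yes q) (yes r) _ = contradiction (ℕ.<-trans q r) (ℕ.<-asym p)
  go (yes _) (no _) (no _) (yes _) (no _) _ = refl
  go (yes _) (no _) (no _) (no _) (yes _) _ = refl
  go (yes _) (no _) (no _) (no _) (no _) _ = refl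
  go (no _) (yes refl) (no _) (yes q) (yes r) _ = contradiction r (ℕ.<-asym q)
  go (no _) (yes refl) (no _) (yes q) (no _) (yes refl) = contradiction q (ℕ.<-irrefl refl)
  go (no _) (yes refl) (no _) (yes _) (no _) (no _) = refl
  go (no _) (yes refl) (no _) (no _) (yes q) (yes refl) = contradiction q (ℕ.<-irrefl refl)
  go (no _) (yes refl) (no _) (no _) (yes _) (no _) = refl
  go (no _) (yes refl) (no _) (no _) (no _) (yes _) = refl
  go (no _) (yes refl) (no _) (no p) (no q) (no r) =
    contradiction (ℕ.≤-antisym (ℕ.≮⇒≥ q) (ℕ.≮⇒≥ p)) r
  go (no _) (no _) (yes _) (yes _) (yes _) _ = refl
  go (no _) (no _) (yes _) (yes _) (no _) _ = refl
  go (no _) (no _) (yes _) (no _) (yes _) _ = refl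
  go (no _) (no _) (yes p) (no q) (no r) _ = contradiction (ℕ.≤-<-trans (ℕ.≮⇒≥ q) p) r

Σ-allFin-suc : ∀ p (f : ℕ → ℤ) →
  Σ[ allFin (suc p) ] (f ∘ toℕ) ≡ f 0 ℤ.+ Σ[ allFin p ] (f ∘ suc ∘ toℕ)
Σ-allFin-suc p f = cong (ℤ._+_ (f 0)) (trans
  (cong (λ xs → Σ[ xs ] (f ∘ toℕ)) (sym (map-tabulate {n = p} (λ i → i) Fin.suc)))
  (Σ-map (allFin p)))

-- Both sides sum `f` over 0, ..., p.
Σ-allFin-shift : ∀ p (f : ℕ → ℤ) →
  Σ[ allFin p ] (f ∘ suc ∘ toℕ) ℤ.+ f 0 ≡ Σ[ allFin p ] (f ∘ toℕ) ℤ.+ f p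
Σ-allFin-shift zero    f = refl
Σ-allFin-shift (suc p) f = begin
  Σ[ allFin (suc p) ] (f ∘ suc ∘ toℕ) ℤ.+ f 0
    ≡⟨ cong (ℤ._+ f 0) (trans (Σ-allFin-suc p (f ∘ suc)) (ℤ.+-comm (f 1) _)) ⟩
  Σ[ allFin p ] (f ∘ suc ∘ suc ∘ toℕ) ℤ.+ f 1 ℤ.+ f 0
    ≡⟨ cong (ℤ._+ f 0) (Σ-allFin-shift p (f ∘ suc)) ⟩
  Σ[ allFin p ] (f ∘ suc ∘ toℕ) ℤ.+ f (suc p) ℤ.+ f 0
    ≡⟨ rotate _ (f (suc p)) (f 0) ⟩
  f 0 ℤ.+ Σ[ allFin p ] (f ∘ suc ∘ toℕ) ℤ.+ f (suc p)
    ≡⟨ cong (ℤ._+ f (suc p)) (Σ-allFin-suc p f) ⟨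
  Σ[ allFin (suc p) ] (f ∘ toℕ) ℤ.+ f (suc p) ∎
  where
  open ≡-Reasoning
  open +-*-Solver using (solve; _:=_; _:+_; _:*_; _:-_; :-_)
  rotate : ∀ a b c → a ℤ.+ b ℤ.+ c ≡ c ℤ.+ a ℤ.+ b
  rotate = solve 3 (λ a b c → a :+ b :+ c := c :+ a :+ b) refl

valueAt-top : ∀ {n p} (c : Vec (Fin n) p) → valueAt c p ≡ 0
valueAt-top []      = refl
valueAt-top (a ∷ c) = valueAt-top c

valueAt-lookup : ∀ {n p} (c : Vec (Fin n) p) r → valueAt c (toℕ r) ≡ suc (toℕ (lookup c r))
valueAt-lookup (a ∷ c) Fin.zero    = refl
valueAt-lookup (a ∷ c) (Fin.suc r) = valueAt-lookup c r

module Diagram (ps : List ℕ) where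

  ∈-dg : (u : Cell ps) → u ∈ dg ps
  ∈-dg (i , r) = ∈-concat⁺′ (∈-map⁺ (i ,_) (∈-allFin r)) (∈-map⁺ _ (∈-allFin i))

  dg-unique : Unique (dg ps)
  dg-unique = Unique.concat⁺
    (All.map⁺ (All.universal (λ i → Unique.map⁺ (λ where refl → refl) (Unique.allFin⁺ _)) _))
    (AllPairs.map⁺ (AllPairs.map disjoint (Unique.allFin⁺ _)))
    where
    disjoint : ∀ {i j} → i ≢ j → ∀ {u : Cell ps} →
      ¬ (u ∈ map (i ,_) (allFin _) × u ∈ map (j ,_) (allFin _))
    disjoint i≢j (u∈ , u∈′) with ∈-map⁻ _ u∈ | ∈-map⁻ _ u∈′
    ... | _ , _ , refl | _ , _ , refl = i≢j refl

  Σ-dg : ∀ (f : Cell ps → ℤ) → Σ[ dg ps ] f ≡ Σ[ allFin _ ] (λ i → Σ[ allFin _ ] (λ r → f (i , r)))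
  Σ-dg f = trans (Σ-concatMap (allFin (length ps)))
    (Σ-cong′ (allFin (length ps)) λ i → Σ-map (allFin (List.lookup ps i)))

  -- The cells above row 1 are the upper neighbours of the other cells.
  Σ-above : ∀ {n} (σ : Filling ps n) (φ : Fin (length ps) → ℕ → ℕ → ℤ) →
    (∀ i a → φ i 0 a ≡ 0ℤ) → (∀ i r → φ i r 0 ≡ 0ℤ) →
    Σ[ dg ps ] (λ (u@(i , r)) → φ i (suc (toℕ r)) (above σ u)) ≡
    Σ[ dg ps ] (λ (u@(i , r)) → φ i (toℕ r) (value σ u))
  Σ-above σ φ φ₁ φ₂ = trans (Σ-dg _) (trans (Σ-cong′ (allFin (length ps)) col) (sym (Σ-dg _)))
    where
    col : ∀ i → Σ[ allFin _ ] (λ r → φ i (suc (toℕ r)) (above σ (i , r))) ≡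
      Σ[ allFin _ ] (λ r → φ i (toℕ r) (value σ (i , r)))
    col i = begin
      Σ[ allFin p ] (f ∘ suc ∘ toℕ)           ≡⟨ ℤ.+-identityʳ _ ⟨
      Σ[ allFin p ] (f ∘ suc ∘ toℕ) ℤ.+ 0ℤ
        ≡⟨ cong (λ z → Σ[ allFin p ] (f ∘ suc ∘ toℕ) ℤ.+ z) (φ₁ i _) ⟨
      Σ[ allFin p ] (f ∘ suc ∘ toℕ) ℤ.+ f 0   ≡⟨ Σ-allFin-shift p f ⟩
      Σ[ allFin p ] (f ∘ toℕ) ℤ.+ f p
        ≡⟨ cong (λ z → Σ[ allFin p ] (f ∘ toℕ) ℤ.+ z)
             (trans (cong (φ i p) (valueAt-top (column σ i))) (φ₂ i p)) ⟩
      Σ[ allFin p ] (f ∘ toℕ) ℤ.+ 0ℤ          ≡⟨ ℤ.+-identityʳ _ ⟩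
      Σ[ allFin p ] (f ∘ toℕ)                 ∎
      where
      open ≡-Reasoning
      p = List.lookup ps i
      f : ℕ → ℤ
      f r = φ i r (valueAt (column σ i) r)

  Left UpLeft Up _◃_ : Cell ps → Cell ps → Set
  Left   (i , r) (j , s) = toℕ r ≡ toℕ s × i Fin.< j
  UpLeft (i , r) (j , s) = toℕ s ≡ suc (toℕ r) × j Fin.< i
  Up     (i , r) (j , s) = toℕ s ≡ suc (toℕ r) × j ≡ i
  -- The reading order: rows from the bottom, each from the left.
  (i , r) ◃ (j , s) = toℕ r < toℕ s ⊎ (toℕ r ≡ toℕ s × i Fin.< j)

  left? : ∀ u v → Dec (Left u v)
  left? (i , r) (j , s) = toℕ r ℕ.≟ toℕ s ×-dec i Fin.<? j

  upLeft? : ∀ u v → Dec (UpLeft u v)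
  upLeft? (i , r) (j , s) = toℕ s ℕ.≟ suc (toℕ r) ×-dec j Fin.<? i

  up? : ∀ u v → Dec (Up u v)
  up? (i , r) (j , s) = toℕ s ℕ.≟ suc (toℕ r) ×-dec j Fin.≟ i

  arm : Cell ps → ℤ
  arm u = Σ[ dg ps ] (λ v → ⟦ left? u v ⟧)

  -- This is e(u,v). The arm arises since every cell to the right of `u` in its row contributes the
  -- same term -[σ(u) < σ(cell above u)].
  bond : Cell ps → Cell ps → ℤ
  bond u v = ⟦ left? u v ⟧ ℤ.+ ⟦ upLeft? u v ⟧ ℤ.- ⟦ up? u v ⟧ ℤ.* arm u

  bond-attack : ∀ u v → Left u v ⊎ UpLeft u v → bond u v ≡ 1ℤ
  bond-attack u v (inj₁ l) = cong₂ ℤ._-_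
    (cong₂ ℤ._+_ (⟦⟧-yes (left? u v) l)
      (⟦⟧-no (upLeft? u v) λ (e , _) → ℕ.1+n≢n (sym (trans (proj₁ l) e))))
    (cong (ℤ._* arm u) (⟦⟧-no (up? u v) λ (e , _) → ℕ.1+n≢n (sym (trans (proj₁ l) e))))
  bond-attack u v (inj₂ l) = cong₂ ℤ._-_
    (cong₂ ℤ._+_ (⟦⟧-no (left? u v) λ (e , _) → ℕ.1+n≢n (sym (trans e (proj₁ l))))
      (⟦⟧-yes (upLeft? u v) l))
    (cong (ℤ._* arm u) (⟦⟧-no (up? u v) λ where (_ , refl) → ℕ.<-irrefl refl (proj₂ l)))

  bond-none : ∀ u v → ¬ Left u v → ¬ UpLeft u v → ¬ Up u v → bond u v ≡ 0ℤ
  bond-none u v ¬l ¬ul ¬u = cong₂ ℤ._-_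
    (cong₂ ℤ._+_ (⟦⟧-no (left? u v) ¬l) (⟦⟧-no (upLeft? u v) ¬ul))
    (cong (ℤ._* arm u) (⟦⟧-no (up? u v) ¬u))

  bond-◃ : ∀ u v → ¬ u ◃ v → bond u v ≡ 0ℤ
  bond-◃ u v ¬◃ = bond-none u v (¬◃ ∘ inj₂)
    (λ (e , _) → ¬◃ (inj₁ (ℕ.≤-reflexive (sym e))))
    (λ (e , _) → ¬◃ (inj₁ (ℕ.≤-reflexive (sym e))))

  between-left : ∀ u w {a} → Left u w → u ◃ a → a ◃ w → Left u a × Left a w
  between-left u w (e , _) (inj₁ p) (inj₁ q) = contradiction (ℕ.<-trans p q) (ℕ.<-irrefl e)
  between-left u w (e , _) (inj₁ p) (inj₂ (q , _)) = contradiction p (ℕ.<-irrefl (trans e (sym q)))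
  between-left u w (e , _) (inj₂ (p , _)) (inj₁ q) = contradiction q (ℕ.<-irrefl (trans (sym p) e))
  between-left u w (e , _) (inj₂ p) (inj₂ q) = p , q

  -- A cell read between `u` and `w` is either to the right of `u` in the lower row or to the left
  -- of `w` in the upper row. As `w` is not to the right of `u`, either way both of its bonds are of
  -- the attacking kind.
  between-up : ∀ (u@(i , r) w@(j , s) : Cell ps) {a} → toℕ s ≡ suc (toℕ r) → j Fin.≤ i →
    u ◃ a → a ◃ w → (Left u a ⊎ UpLeft u a) × (Left a w ⊎ UpLeft a w)
  between-up u w e j≤i (inj₁ p) (inj₁ q) =
    contradiction (ℕ.<-≤-trans q (ℕ.≤-trans (ℕ.≤-reflexive e) p)) (ℕ.<-irrefl refl)
  between-up u w e j≤i (inj₁ p) (inj₂ (q , k<j)) =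
    inj₂ (trans q e , ℕ.<-≤-trans k<j j≤i) , inj₁ (q , k<j)
  between-up u w e j≤i (inj₂ (p , i<k)) (inj₁ q) =
    inj₁ (p , i<k) , inj₂ (trans e (cong suc p) , ℕ.≤-<-trans j≤i i<k)
  between-up u w e j≤i (inj₂ (p , _)) (inj₂ (q , _)) =
    contradiction (trans (sym e) (trans (sym q) (sym p))) ℕ.1+n≢n

  -- In the second alternative both bonds of a cell in between are 1. No value is prescribed for
  -- `bond u w` itself, so a vertical pair may carry minus an arm.
  bond-corners : ∀ u w → bond u w ≡ 0ℤ ⊎ (∀ {a} → u ◃ a → a ◃ w → bond u a ≡ bond a w)
  bond-corners u w with left? u w | upLeft? u w | up? u w
  ... | yes l | _ | _ = inj₂ λ {a} p q → let l₁ , l₂ = between-left u w l p q in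
    trans (bond-attack u a (inj₁ l₁)) (sym (bond-attack a w (inj₁ l₂)))
  ... | no _ | yes (e , j<i) | _ = inj₂ λ {a} p q →
    let l₁ , l₂ = between-up u w e (ℕ.<⇒≤ j<i) p q in
    trans (bond-attack u a l₁) (sym (bond-attack a w l₂))
  ... | no _ | no _ | yes (e , refl) = inj₂ λ {a} p q →
    let l₁ , l₂ = between-up u w e ℕ.≤-refl p q in
    trans (bond-attack u a l₁) (sym (bond-attack a w l₂))
  ... | no ¬l | no ¬ul | no ¬u = inj₁ (bond-none u w ¬l ¬ul ¬u)

  module _ {n} (σ : Filling ps n) where

    asc : Cell ps → Cell ps → ℤ
    asc u v = ⟦ value σ u ℕ.<? value σ v ⟧

    private
      D = dg ps

    -- Passing from `u` to the cell above it leads from the cells left of `v` to those one row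
    -- higher and to the left; where that cell is missing, the value 0 gives no contribution.
    Σ-upLeft : ∀ v → Σ[ D ] (λ u → ⟦ left? u v ⟧ ℤ.* ⟦ value σ v ℕ.<? above σ u ⟧)
      ≡ Σ[ D ] (λ w → ⟦ upLeft? v w ⟧ ℤ.* asc v w)
    Σ-upLeft v@(j , s) = Σ-above σ
      (λ i r a → ⟦ r ℕ.≟ suc (toℕ s) ×-dec i Fin.<? j ⟧ ℤ.* ⟦ value σ v ℕ.<? a ⟧)
      (λ i a → refl) (λ i r → ℤ.*-zeroʳ ⟦ r ℕ.≟ suc (toℕ s) ×-dec i Fin.<? j ⟧)

    -- The sum has at most one term. Shifting it down by `Σ-above` gives exactly one term, at `u`,
    -- and avoids asking whether `u` is the top of its column.
    Σ-up : ∀ u → Σ[ D ] (λ v → ⟦ up? u v ⟧ ℤ.* asc u v) ≡ ⟦ value σ u ℕ.<? above σ u ⟧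
    Σ-up u@(i , r) = trans
      (sym (Σ-above σ
        (λ j s a → ⟦ s ℕ.≟ suc (toℕ r) ×-dec j Fin.≟ i ⟧ ℤ.* ⟦ value σ u ℕ.<? a ⟧)
        (λ j a → refl) (λ j s → ℤ.*-zeroʳ ⟦ s ℕ.≟ suc (toℕ r) ×-dec j Fin.≟ i ⟧)))
      (trans (Σ-single dg-unique (∈-dg u) off)
        (trans (cong (ℤ._* ⟦ value σ u ℕ.<? above σ u ⟧)
          (⟦⟧-yes (suc (toℕ r) ℕ.≟ suc (toℕ r) ×-dec i Fin.≟ i) (refl , refl)))
          (ℤ.*-identityˡ _)))
      where
      off : ∀ v → v ≢ u → ⟦ suc (toℕ (proj₂ v)) ℕ.≟ suc (toℕ r) ×-dec proj₁ v Fin.≟ i ⟧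
        ℤ.* ⟦ value σ u ℕ.<? above σ v ⟧ ≡ 0ℤ
      off (j , s) v≢u = cong (ℤ._* ⟦ value σ u ℕ.<? above σ (j , s) ⟧)
        (⟦⟧-no (suc (toℕ s) ℕ.≟ suc (toℕ r) ×-dec j Fin.≟ i)
          λ where (e , refl) → v≢u (cong (i ,_) (Fin.toℕ-injective (ℕ.suc-injective e))))

    quinv-bonds : + quinv σ ≡ Σ[ D ] (λ u → Σ[ D ] (λ v → bond u v ℤ.* asc u v))
    quinv-bonds = begin
      + quinv σ
        ≡⟨ trans (length-filter (QuinvPair? σ) (cartesianProduct D D))
             (Σ-cartesianProductWith D D) ⟩
      Σ[ D ] (λ u → Σ[ D ] (λ v → ⟦ QuinvPair? σ (u , v) ⟧))
        ≡⟨ Σ-cong′ D (λ u → trans (Σ-cong′ D (pair u)) (trans (Σ-+₃ _ _ _)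
             (cong (ℤ._+_ (A u ℤ.+ B u)) (Σ-* D (- ⟦ value σ u ℕ.<? above σ u ⟧))))) ⟩
      Σ[ D ] (λ u → A u ℤ.+ B u ℤ.+ - ⟦ value σ u ℕ.<? above σ u ⟧ ℤ.* arm u)
        ≡⟨ Σ-+₃ A B _ ⟩
      Σ[ D ] A ℤ.+ Σ[ D ] B ℤ.+ Σ[ D ] (λ u → - ⟦ value σ u ℕ.<? above σ u ⟧ ℤ.* arm u)
        -- After exchanging the two sums, the bracket [σ(v) < σ(cell above u)] is charged to `v` and
        -- the cell above `u`.
        ≡⟨ cong₂ (λ y z → Σ[ D ] A ℤ.+ y ℤ.+ z)
             (trans (Σ-comm D D) (Σ-cong′ D Σ-upLeft)) (Σ-cong′ D vertical) ⟩
      Σ[ D ] A ℤ.+ Σ[ D ] B′ ℤ.+ Σ[ D ] C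
        ≡⟨ Σ-+₃ A B′ C ⟨
      Σ[ D ] (λ u → A u ℤ.+ B′ u ℤ.+ C u)
        ≡⟨ Σ-cong′ D (λ u → trans (Σ-cong′ D (split u))
             (trans (Σ-+₃ _ _ _) (cong (ℤ._+_ (A u ℤ.+ B′ u)) (Σ-* D (- arm u))))) ⟨
      Σ[ D ] (λ u → Σ[ D ] (λ v → bond u v ℤ.* asc u v)) ∎
      where
      open ≡-Reasoning
      open +-*-Solver using (solve; _:=_; _:+_; _:*_; _:-_; :-_)
      A B B′ C : Cell ps → ℤ
      A u = Σ[ D ] (λ v → ⟦ left? u v ⟧ ℤ.* asc u v)
      B u = Σ[ D ] (λ v → ⟦ left? u v ⟧ ℤ.* ⟦ value σ v ℕ.<? above σ u ⟧)
      B′ u = Σ[ D ] (λ v → ⟦ upLeft? u v ⟧ ℤ.* asc u v)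
      C u = - arm u ℤ.* Σ[ D ] (λ v → ⟦ up? u v ⟧ ℤ.* asc u v)

      Σ-+₃ : ∀ f g h → Σ[ D ] (λ u → f u ℤ.+ g u ℤ.+ h u) ≡ Σ[ D ] f ℤ.+ Σ[ D ] g ℤ.+ Σ[ D ] h
      Σ-+₃ f g h = trans (Σ-+ D) (cong (ℤ._+ Σ[ D ] h) (Σ-+ D))

      pair : ∀ u v → ⟦ QuinvPair? σ (u , v) ⟧ ≡
        ⟦ left? u v ⟧ ℤ.* asc u v ℤ.+ ⟦ left? u v ⟧ ℤ.* ⟦ value σ v ℕ.<? above σ u ⟧ ℤ.+
        - ⟦ value σ u ℕ.<? above σ u ⟧ ℤ.* ⟦ left? u v ⟧
      pair u@(i , r) v@(j , s) = begin
        ⟦ QuinvPair? σ (u , v) ⟧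
          ≡⟨ ⟦⟧-× (toℕ r ℕ.≟ toℕ s) (i Fin.<? j) (𝒬? (above σ u) (value σ u) (value σ v)) ⟩
        ⟦ left? u v ⟧ ℤ.* ⟦ 𝒬? (above σ u) (value σ u) (value σ v) ⟧
          ≡⟨ cong (⟦ left? u v ⟧ ℤ.*_) (𝒬-count (above σ u) (value σ u) (value σ v)) ⟩
        ⟦ left? u v ⟧ ℤ.* (asc u v ℤ.+ ⟦ value σ v ℕ.<? above σ u ⟧
          ℤ.- ⟦ value σ u ℕ.<? above σ u ⟧)
          ≡⟨ solve 4 (λ l a b c → l :* (a :+ b :- c) := l :* a :+ l :* b :+ :- c :* l) refl
               ⟦ left? u v ⟧ (asc u v) ⟦ value σ v ℕ.<? above σ u ⟧
               ⟦ value σ u ℕ.<? above σ u ⟧ ⟩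
        _ ∎

      vertical : ∀ u → - ⟦ value σ u ℕ.<? above σ u ⟧ ℤ.* arm u ≡ C u
      vertical u = trans (solve 2 (λ a b → :- a :* b := :- b :* a) refl
        ⟦ value σ u ℕ.<? above σ u ⟧ (arm u)) (cong (- arm u ℤ.*_) (sym (Σ-up u)))

      split : ∀ u v → bond u v ℤ.* asc u v ≡
        ⟦ left? u v ⟧ ℤ.* asc u v ℤ.+ ⟦ upLeft? u v ⟧ ℤ.* asc u v ℤ.+
        - arm u ℤ.* (⟦ up? u v ⟧ ℤ.* asc u v)
      split u v = solve 5 (λ l a b c d → (l :+ a :- b :* c) :* d :=
        l :* d :+ a :* d :+ :- c :* (b :* d)) refl
        ⟦ left? u v ⟧ ⟦ upLeft? u v ⟧ ⟦ up? u v ⟧ (arm u) (asc u v)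

-- The cells in reading order

Unique-resp-↭ : ∀ {A : Set} {xs ys : List A} → xs ↭ ys → Unique xs → Unique ys
Unique-resp-↭ p = ↭ₛ.Unique-resp-↭ (setoid _) (↭.↭⇒↭ₛ p)

module Reading (ps : List ℕ) where

  open Diagram ps

  ◃-asym : ∀ (u v : Cell ps) → u ◃ v → ¬ v ◃ u
  ◃-asym u v (inj₁ p)       (inj₁ q)       = ℕ.<-asym p q
  ◃-asym u v (inj₁ p)       (inj₂ (e , _)) = ℕ.<-irrefl (sym e) p
  ◃-asym u v (inj₂ (e , _)) (inj₁ q)       = ℕ.<-irrefl (sym e) q
  ◃-asym u v (inj₂ (_ , p)) (inj₂ (_ , q)) = ℕ.<-asym p q

  Cell-decTotalOrder : DecTotalOrder _ _ _
  Cell-decTotalOrder = On.decTotalOrder (×-decTotalOrder ℕ.≤-decTotalOrder ℕ.≤-decTotalOrder)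
    (λ ((i , r) : Cell ps) → toℕ r , toℕ i)

  open Sort Cell-decTotalOrder using (sort; sort-↭; sort-↗)

  reading : List (Cell ps)
  reading = sort (dg ps)

  reading-↭ : reading ↭ dg ps
  reading-↭ = sort-↭ (dg ps)

  reading-unique : Unique reading
  reading-unique = Unique-resp-↭ (↭-sym reading-↭) dg-unique

  reading-sorted : AllPairs _◃_ reading
  reading-sorted = AllPairs.zipWith
    (λ {u} {v} (p , q) → strict u v p q)
    (Linked⇒AllPairs (DecTotalOrder.trans Cell-decTotalOrder) (sort-↗ (dg ps)) , reading-unique)
    where
    strict : ∀ (u v : Cell ps) → DecTotalOrder._≤_ Cell-decTotalOrder u v → u ≢ v → u ◃ v
    strict u v (inj₁ (p , q)) u≢v = inj₁ (ℕ.≤∧≢⇒< p q)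
    strict (i , r) (j , s) (inj₂ (p , q)) u≢v with i Fin.≟ j
    ... | yes refl = contradiction (cong (i ,_) (Fin.toℕ-injective p)) u≢v
    ... | no i≢j   = inj₂ (p , ℕ.≤∧≢⇒< q (i≢j ∘ Fin.toℕ-injective))

  ∈-reading : ∀ u → u ∈ reading
  ∈-reading u = ∈-resp-↭ (↭-sym reading-↭) (∈-dg u)

-- Fillings as words

lookup-ext : ∀ {A : Set} {n} {v w : Vec A n} → (∀ k → lookup v k ≡ lookup w k) → v ≡ w
lookup-ext {v = v} {w} eq =
  trans (sym (Vec.tabulate∘lookup v)) (trans (Vec.tabulate-cong eq) (Vec.tabulate∘lookup w))

fill : ∀ {n} ps → (Cell ps → Fin n) → Filling ps n
fill []       f = []
fill (p ∷ ps) f = tabulate (λ r → f (Fin.zero , r)) ∷ fill ps (λ (i , r) → f (Fin.suc i , r))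

fill-at : ∀ {n} ps (f : Cell ps → Fin n) u → fill ps f at u ≡ f u
fill-at (p ∷ ps) f (Fin.zero  , r) = Vec.lookup∘tabulate _ r
fill-at (p ∷ ps) f (Fin.suc i , r) = fill-at ps _ (i , r)

fill-η : ∀ {n} ps (σ : Filling ps n) f → (∀ u → f u ≡ σ at u) → fill ps f ≡ σ
fill-η []       []      f eq = refl
fill-η (p ∷ ps) (c ∷ σ) f eq = cong₂ _∷_
  (trans (Vec.tabulate-cong (λ r → eq (Fin.zero , r))) (Vec.tabulate∘lookup c))
  (fill-η ps σ _ λ (i , r) → eq (Fin.suc i , r))

module FillingWords (ps : List ℕ) (n : ℕ) where

  open Reading ps

  private
    rd : List (Cell ps)
    rd = reading

  word : Filling ps n → Vec (Fin n) (length rd)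
  word σ = Vec.map (σ at_) (fromList rd)

  fromWord : Vec (Fin n) (length rd) → Filling ps n
  fromWord w = fill ps (λ u → lookup w (Any.index (∈-reading u)))

  index-∈-reading : ∀ k → Any.index (∈-reading (List.lookup rd k)) ≡ k
  index-∈-reading k = trans
    (cong Any.index (unique⇒irrelevant reading-unique (∈-reading (List.lookup rd k)) (∈-lookup k)))
    (index-∈-lookup rd k)
    where
    index-∈-lookup : ∀ {A : Set} (xs : List A) k → Any.index (∈-lookup {xs = xs} k) ≡ k
    index-∈-lookup (x ∷ xs) Fin.zero    = refl
    index-∈-lookup (x ∷ xs) (Fin.suc k) = cong Fin.suc (index-∈-lookup xs k)

  lookup-fromList : ∀ {A : Set} (xs : List A) k → lookup (fromList xs) k ≡ List.lookup xs k
  lookup-fromList (x ∷ xs) Fin.zero    = refl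
  lookup-fromList (x ∷ xs) (Fin.suc k) = lookup-fromList xs k

  word-fromWord : ∀ w → word (fromWord w) ≡ w
  word-fromWord w = lookup-ext λ k → begin
    lookup (word (fromWord w)) k
      ≡⟨ Vec.lookup-map k _ (fromList rd) ⟩
    fromWord w at lookup (fromList rd) k
      ≡⟨ cong (fromWord w at_) (lookup-fromList rd k) ⟩
    fromWord w at List.lookup rd k
      ≡⟨ fill-at ps _ (List.lookup rd k) ⟩
    lookup w (Any.index (∈-reading (List.lookup rd k)))
      ≡⟨ cong (lookup w) (index-∈-reading k) ⟩
    lookup w k ∎
    where open ≡-Reasoning

  fromWord-word : ∀ σ → fromWord (word σ) ≡ σ
  fromWord-word σ = fill-η ps σ _ λ u → begin
    lookup (word σ) (Any.index (∈-reading u))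
      ≡⟨ Vec.lookup-map (Any.index (∈-reading u)) _ (fromList rd) ⟩
    σ at lookup (fromList rd) (Any.index (∈-reading u))
      ≡⟨ cong (σ at_) (lookup-fromList rd (Any.index (∈-reading u))) ⟩
    σ at List.lookup rd (Any.index (∈-reading u))
      ≡⟨ cong (σ at_) (Any.lookup-index (∈-reading u)) ⟨
    σ at u ∎
    where open ≡-Reasoning

  Words : List (Vec (Fin n) (length rd))
  Words = vecs (allFin n) (length rd)

  -- Both lists are free of repetitions and contain every filling.
  Tab-↭ : Tab ps n ↭ map fromWord Words
  Tab-↭ = ∼bag⇒↭ (unique∧set⇒bag (Tab-unique ps n)
    (Unique.map⁺ (λ {w} {w′} eq → trans (sym (word-fromWord w))
      (trans (cong word eq) (word-fromWord w′))) (vecs-unique (Unique.allFin⁺ n) (length rd)))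
    (λ {σ} → mk⇔
      (λ _ → subst (_∈ map fromWord Words) (fromWord-word σ) (∈-map⁺ fromWord (∈-words (word σ))))
      (λ _ → Tab-complete σ)))
    where
    ∈-words : ∀ {k} (w : Vec (Fin n) k) → w ∈ vecs (allFin n) k
    ∈-words w = ∈-vecs (VecAll.universal ∈-allFin w)

-- Monomials in t^±1, x₁, …, xₙ: the bond of a vertical pair of cells is negative.
Laurent : ℕ → Set
Laurent n = ℤ × Monomial n

infixl 7 _•_
_•_ : ∀ {n} → Laurent n → Laurent n → Laurent n
(a , d) • (b , e) = a ℤ.+ b , d · e

1ₘ : ∀ {n} → Monomial n
1ₘ = replicate _ 0

·-assoc : ∀ {n} (d e f : Monomial n) → (d · e) · f ≡ d · (e · f)
·-assoc = Vec.zipWith-assoc ℕ.+-assoc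

·-comm : ∀ {n} (d e : Monomial n) → d · e ≡ e · d
·-comm = Vec.zipWith-comm ℕ.+-comm

·-identityˡ : ∀ {n} (d : Monomial n) → 1ₘ · d ≡ d
·-identityˡ = Vec.zipWith-identityˡ ℕ.+-identityˡ

·-identityʳ : ∀ {n} (d : Monomial n) → d · 1ₘ ≡ d
·-identityʳ = Vec.zipWith-identityʳ ℕ.+-identityʳ

•-isCommutativeMonoid : ∀ {n} → IsCommutativeMonoid _≡_ (_•_ {n}) (0ℤ , 1ₘ)
•-isCommutativeMonoid = record
  { isMonoid = record
    { isSemigroup = record
      { isMagma = record { isEquivalence = isEquivalence ; ∙-cong = cong₂ _•_ }
      ; assoc   = λ (a , d) (b , e) (c , f) → cong₂ _,_ (ℤ.+-assoc a b c) (·-assoc d e f)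
      }
    ; identity = (λ (a , d) → cong₂ _,_ (ℤ.+-identityˡ a) (·-identityˡ d))
               , (λ (a , d) → cong₂ _,_ (ℤ.+-identityʳ a) (·-identityʳ d))
    }
  ; comm = λ (a , d) (b , e) → cong₂ _,_ (ℤ.+-comm a b) (·-comm d e)
  }

unit : ∀ {n} → Fin n → Monomial n
unit i = 1ₘ [ i ]≔ 1

-- Weights of fillings as weights of words

module Weights (ps : List ℕ) (n : ℕ) where

  open Diagram ps
  open Reading ps
  open FillingWords ps n

  content : (Fin n → Fin n) → Filling ps n → List (Cell ps) → Monomial n
  content ρ σ []       = 1ₘ
  content ρ σ (u ∷ us) = unit (ρ (σ at u)) · content ρ σ us

  content-↭ : ∀ ρ σ {us vs} → us ↭ vs → content ρ σ us ≡ content ρ σ vs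
  content-↭ ρ σ ↭.refl         = refl
  content-↭ ρ σ (↭.prep u p)   = cong (_ ·_) (content-↭ ρ σ p)
  content-↭ ρ σ (↭.swap u v p) = trans (cong (λ d → _ · (_ · d)) (content-↭ ρ σ p))
    (trans (sym (·-assoc _ _ _)) (trans (cong (_· _) (·-comm _ _)) (·-assoc _ _ _)))
  content-↭ ρ σ (↭.trans p q)  = trans (content-↭ ρ σ p) (content-↭ ρ σ q)

  laurent : (Fin n → Fin n) → Filling ps n → Laurent n
  laurent ρ σ = + quinv σ , content ρ σ (dg ps)

  open MultisetSemiring (•-isCommutativeMonoid {n}) using (commutativeSemiring; Σ-filter)

  private
    module Σᴸ = Sums commutativeSemiring

  κ : Cell ps → Cell ps → List (Laurent n)
  κ u v = (bond u v , 1ₘ) ∷ []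

  κ-corners : ∀ u w → κ u w ↭ (0ℤ , 1ₘ) ∷ [] ⊎ (∀ {a} → u ◃ a → a ◃ w → κ u a ↭ κ a w)
  κ-corners u w with bond-corners u w
  ... | inj₁ eq = inj₁ (↭-reflexive (cong (λ z → (z , 1ₘ) ∷ []) eq))
  ... | inj₂ eq = inj₂ λ p q → ↭-reflexive (cong (λ z → (z , 1ₘ) ∷ []) (eq p q))

  module TL = TwoLetters commutativeSemiring (λ xs ys zs → ++-cancelˡ-↭ xs) κ _◃_
    κ-corners

  letter : (Fin n → Fin n) → Fin n → List (Laurent n)
  letter ρ a = (0ℤ , unit (ρ a)) ∷ []

  module Swap {p q : Fin n} (q≡1+p : toℕ q ≡ suc (toℕ p)) where

    p<q : p Fin.< q
    p<q = ℕ.≤-reflexive (sym q≡1+p)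

    _<ᵇ_ : Fin n → Fin n → Bool
    a <ᵇ b = does (a Fin.<? b)

    <ᵇ-adjacentˡ : ∀ {o} → o ≢ p → o ≢ q → p <ᵇ o ≡ q <ᵇ o
    <ᵇ-adjacentˡ {o} o≢p o≢q = does-⇔ (mk⇔
      (λ p<o → ℕ.≤∧≢⇒< (subst (ℕ._≤ toℕ o) (sym q≡1+p) p<o) (o≢q ∘ sym ∘ Fin.toℕ-injective))
      (ℕ.<-trans p<q)) (p Fin.<? o) (q Fin.<? o)

    <ᵇ-adjacentʳ : ∀ {o} → o ≢ p → o ≢ q → o <ᵇ p ≡ o <ᵇ q
    <ᵇ-adjacentʳ {o} o≢p o≢q = does-⇔ (mk⇔
      (λ o<p → ℕ.<-trans o<p p<q)
      (λ o<q → ℕ.≤∧≢⇒< (ℕ.s≤s⁻¹ (subst (toℕ o ℕ.<_) q≡1+p o<q)) (o≢p ∘ Fin.toℕ-injective)))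
      (o Fin.<? p) (o Fin.<? q)

    module W = TL.Words _<ᵇ_ p q
      (dec-false (p Fin.<? p) (ℕ.<-irrefl refl))
      (dec-true (p Fin.<? q) p<q)
      (dec-false (q Fin.<? p) (ℕ.<-asym p<q))
      (dec-false (q Fin.<? q) (ℕ.<-irrefl refl))
      <ᵇ-adjacentˡ <ᵇ-adjacentʳ

    bonds : ∀ {k} → Cell ps → Fin n → Vec (Cell ps) k → Vec (Fin n) k → ℤ
    bonds u a []       []      = 0ℤ
    bonds u a (v ∷ vs) (b ∷ w) = (if a <ᵇ b then bond u v else 0ℤ) ℤ.+ bonds u a vs w

    interaction-bonds : ∀ {k} u a (vs : Vec _ k) w →
      W.interaction u a vs w ≡ (bonds u a vs w , 1ₘ) ∷ []
    interaction-bonds u a []       []      = refl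
    interaction-bonds u a (v ∷ vs) (b ∷ w)
      rewrite interaction-bonds u a vs w with does (a Fin.<? b)
    ... | true  = cong (λ d → (bond u v ℤ.+ bonds u a vs w , d) ∷ []) (·-identityˡ 1ₘ)
    ... | false = cong (λ d → (0ℤ ℤ.+ bonds u a vs w , d) ∷ []) (·-identityˡ 1ₘ)

    -- The word weight has a factor for each pair in reading order, the double sum a term for each
    -- ordered pair; the additional bonds vanish by `bond-◃`.
    weight-word : ∀ ρ σ us → AllPairs _◃_ us →
      W.weight (letter ρ) (fromList us) (Vec.map (σ at_) (fromList us))
        ≡ (Σ[ us ] (λ u → Σ[ us ] (λ v → bond u v ℤ.* asc σ u v)) , content ρ σ us) ∷ []
    weight-word ρ σ []       _                = refl
    weight-word ρ σ (u ∷ us) (u◃ ∷ sorted)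
      rewrite interaction-bonds u (σ at u) (fromList us) (Vec.map (σ at_) (fromList us))
      | weight-word ρ σ us sorted = cong₂ (λ a d → (a , d) ∷ []) energy
        (cong (unit (ρ (σ at u)) ·_) (·-identityˡ _))
      where
      B : Cell ps → Cell ps → ℤ
      B v w = bond v w ℤ.* asc σ v w

      B≡0 : ∀ v w → ¬ v ◃ w → B v w ≡ 0ℤ
      B≡0 v w ¬◃ = cong (ℤ._* asc σ v w) (bond-◃ v w ¬◃)

      term : ∀ v w → (if does (σ at v Fin.<? σ at w) then bond v w else 0ℤ) ≡ B v w
      term v w rewrite valueAt-lookup (column σ (proj₁ v)) (proj₂ v)
        | valueAt-lookup (column σ (proj₁ w)) (proj₂ w) with does (σ at v Fin.<? σ at w)
      ... | true  = sym (ℤ.*-identityʳ _)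
      ... | false = sym (ℤ.*-zeroʳ (bond v w))

      bonds-Σ : ∀ vs → bonds u (σ at u) (fromList vs) (Vec.map (σ at_) (fromList vs))
        ≡ Σ[ vs ] (B u)
      bonds-Σ []       = refl
      bonds-Σ (v ∷ vs) = cong₂ ℤ._+_ (term u v) (bonds-Σ vs)

      open ≡-Reasoning

      energy : 0ℤ ℤ.+ (bonds u (σ at u) (fromList us) (Vec.map (σ at_) (fromList us)) ℤ.+
          Σ[ us ] (λ v → Σ[ us ] (B v)))
        ≡ (B u u ℤ.+ Σ[ us ] (B u)) ℤ.+ Σ[ us ] (λ v → B v u ℤ.+ Σ[ us ] (B v))
      energy = begin
        0ℤ ℤ.+ (bonds u (σ at u) (fromList us) (Vec.map (σ at_) (fromList us)) ℤ.+
          Σ[ us ] (λ v → Σ[ us ] (B v)))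
          ≡⟨ ℤ.+-identityˡ _ ⟩
        bonds u (σ at u) (fromList us) (Vec.map (σ at_) (fromList us)) ℤ.+
          Σ[ us ] (λ v → Σ[ us ] (B v))
          ≡⟨ cong₂ ℤ._+_
               (trans (bonds-Σ us) (sym (trans
                 (cong (ℤ._+ Σ[ us ] (B u)) (B≡0 u u (λ u◃u → ◃-asym u u u◃u u◃u)))
                 (ℤ.+-identityˡ _))))
               (Σ-cong u◃ (λ {v} u◃v → sym (trans
                 (cong (ℤ._+ Σ[ us ] (B v)) (B≡0 v u (◃-asym u v u◃v)))
                 (ℤ.+-identityˡ _)))) ⟩
        (B u u ℤ.+ Σ[ us ] (B u)) ℤ.+ Σ[ us ] (λ v → B v u ℤ.+ Σ[ us ] (B v)) ∎

    weight-fromWord : ∀ ρ w → W.weight (letter ρ) (fromList reading) w ≡ laurent ρ (fromWord w) ∷ []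
    weight-fromWord ρ w = begin
      W.weight (letter ρ) (fromList reading) w
        ≡⟨ cong (W.weight (letter ρ) (fromList reading)) (word-fromWord w) ⟨
      W.weight (letter ρ) (fromList reading) (word (fromWord w))
        ≡⟨ weight-word ρ (fromWord w) reading reading-sorted ⟩
      (Σ[ reading ] (λ u → Σ[ reading ] (B u)) , content ρ (fromWord w) reading) ∷ []
        ≡⟨ cong₂ (λ a d → (a , d) ∷ [])
             (trans (Σ-↭ reading-↭) (trans (Σ-cong′ (dg ps) (λ u → Σ-↭ reading-↭))
               (sym (quinv-bonds (fromWord w)))))
             (content-↭ ρ (fromWord w) reading-↭) ⟩
      laurent ρ (fromWord w) ∷ [] ∎
      where
      open ≡-Reasoning
      B : Cell ps → Cell ps → ℤ
      B u v = bond u v ℤ.* asc (fromWord w) u v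

    _∼_ : Fin n → Fin n → Set
    a ∼ b = a ≡ b ⊎ ((a ≡ p ⊎ a ≡ q) × (b ≡ p ⊎ b ≡ q))

    fits-∼ : ∀ {e a b} → W.Fits e a → W.Fits e b → a ∼ b
    fits-∼ W.fits-fixed W.fits-fixed = inj₁ refl
    fits-∼ W.fits-p     W.fits-p     = inj₁ refl
    fits-∼ W.fits-p     W.fits-q     = inj₂ (inj₁ refl , inj₂ refl)
    fits-∼ W.fits-q     W.fits-p     = inj₂ (inj₂ refl , inj₁ refl)
    fits-∼ W.fits-q     W.fits-q     = inj₁ refl

    module _ {P : Pred (Filling ps n) 0ℓ} (P? : Decidable P)
      (P-resp : ∀ {σ τ} → (∀ u → (σ at u) ∼ (τ at u)) → P σ → P τ)
      {ρ : Fin n → Fin n} (ρp : ρ p ≡ q) (ρq : ρ q ≡ p)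
      (ρo : ∀ {o} → o ≢ p → o ≢ q → ρ o ≡ o) where

      others : ∃[ os ] allFin n ↭ p ∷ q ∷ os
      others with ∈-∃++ (∈-allFin p)
      ... | as , bs , eq with ↭-trans (↭-reflexive eq) (shift p as bs)
      ... | allFin↭ with ∈-resp-↭ allFin↭ (∈-allFin q)
      ... | here q≡p  = contradiction (sym (cong toℕ q≡p)) (ℕ.<⇒≢ p<q)
      ... | there q∈ with ∈-∃++ q∈
      ... | cs , ds , eq′ = cs ++ ds ,
        ↭-trans allFin↭ (↭-prep p (↭-trans (↭-reflexive eq′) (shift q cs ds)))

      others-≢ : ∀ {os} → allFin n ↭ p ∷ q ∷ os → All (λ o → o ≢ p × o ≢ q) os
      others-≢ as↭ with Unique-resp-↭ as↭ (Unique.allFin⁺ n)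
      ... | (_ ∷ p≢) ∷ q≢ ∷ _ = All.zipWith (λ (p≢o , q≢o) → p≢o ∘ sym , q≢o ∘ sym) (p≢ , q≢)

      laurent-swap : map (laurent id) (filter P? (Tab ps n)) ↭
        map (laurent ρ) (filter P? (Tab ps n))
      laurent-swap = ↭-trans (to-words id) (↭-trans
        (W.Σ-words-swap {letter id} {letter ρ} (cong (λ a → (0ℤ , unit a) ∷ []) ρp)
          (cong (λ a → (0ℤ , unit a) ∷ []) ρq)
          (λ o≢p o≢q → cong (λ a → (0ℤ , unit a) ∷ []) (ρo o≢p o≢q))
          (fromList reading) (subst (AllPairs _◃_) (sym (toList-fromList reading)) reading-sorted)
          (λ w → does (P? (fromWord w)))
          (λ fs fs′ → does-⇔ (mk⇔ (P-resp (related fs fs′)) (P-resp (related fs′ fs)))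
            (P? _) (P? _))
          (proj₂ others) (others-≢ (proj₂ others)))
        (↭-sym (to-words ρ)))
        where
        toList-fromList = Vec.toList∘fromList

        to-words : ∀ ρ → map (laurent ρ) (filter P? (Tab ps n)) ↭ Σᴸ.Σ[ Words ]
          (λ w → if does (P? (fromWord w)) then W.weight (letter ρ) (fromList reading) w else [])
        to-words ρ = ↭-trans (map⁺ (laurent ρ) (filter-↭ P? Tab-↭))
          (↭-reflexive (sym (Σ-filter P? fromWord (laurent ρ) (weight-fromWord ρ) Words)))

        related : ∀ {s w w′} → VecPointwise.Pointwise W.Fits s w →
          VecPointwise.Pointwise W.Fits s w′ → ∀ u → (fromWord w at u) ∼ (fromWord w′ at u)
        related fs fs′ u = subst₂ _∼_ (sym (fill-at ps _ u)) (sym (fill-at ps _ u))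
          (fits-∼ (VecPointwise.lookup fs k) (VecPointwise.lookup fs′ k))
          where k = Any.index (∈-reading u)

-- Polynomials up to permutation of their terms

-- For this monoid `_⊛_` unfolds to `_*ₚ_`, so the semiring laws hold for products of polynomials up
-- to the order of their terms.
·ₜ-isCommutativeMonoid : ∀ {m} → IsCommutativeMonoid _≡_ (_·ₜ_ {m}) (1ℤ , 1ₘ)
·ₜ-isCommutativeMonoid = record
  { isMonoid = record
    { isSemigroup = record
      { isMagma = record { isEquivalence = isEquivalence ; ∙-cong = cong₂ _·ₜ_ }
      ; assoc   = λ (a , d) (b , e) (c , f) → cong₂ _,_ (ℤ.*-assoc a b c) (·-assoc d e f)
      }
    ; identity = (λ (a , d) → cong₂ _,_ (ℤ.*-identityˡ a) (·-identityˡ d))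
               , (λ (a , d) → cong₂ _,_ (ℤ.*-identityʳ a) (·-identityʳ d))
    }
  ; comm = λ (a , d) (b , e) → cong₂ _,_ (ℤ.*-comm a b) (·-comm d e)
  }

module _ {m : ℕ} where

  ↭⇒≈ : ∀ {p q : Poly m} → p ↭ q → p ≈ q
  ↭⇒≈ {p} {q} p↭q e = trans (coeff-Σ p) (trans (Σ-↭ p↭q) (sym (coeff-Σ q)))
    where
    coeff-Σ : ∀ p → coeff p e ≡ Σ[ p ] (λ (a , d) → if does (d ≟ₘ e) then a else ℤ.0ℤ)
    coeff-Σ []      = refl
    coeff-Σ (u ∷ p) = cong (ℤ._+_ (if does (proj₂ u ≟ₘ e) then proj₁ u else ℤ.0ℤ)) (coeff-Σ p)

  open CommutativeSemiring (MultisetSemiring.commutativeSemiring (·ₜ-isCommutativeMonoid {m}))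
    using (*-cong; *-congˡ; *-congʳ; *-assoc; *-comm; distribʳ)

  sumNum : List (RationalFunction m) → Poly m
  sumNum []       = []
  sumNum (f ∷ fs) = num f +ₚ sumNum fs

  -- Σᵣ does not look for common denominators: if all denominators are z, that of a sum of k
  -- functions is z^k, so one factor z must be left out to compare numerators.
  num-Σᵣ-*z : ∀ z fs → All (λ f → den f ≡ z) fs → num (Σᵣ fs) *ₚ z ↭ sumNum fs *ₚ den (Σᵣ fs)
  num-Σᵣ : ∀ z f fs → All (λ f → den f ≡ z) (f ∷ fs) →
    num (Σᵣ (f ∷ fs)) ↭ sumNum (f ∷ fs) *ₚ den (Σᵣ fs)

  num-Σᵣ z f fs (refl ∷ eqs) = ↭-trans
    (++⁺ˡ (num f *ₚ den (Σᵣ fs)) (num-Σᵣ-*z z fs eqs))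
    (↭-sym (distribʳ (den (Σᵣ fs)) (num f) (sumNum fs)))

  num-Σᵣ-*z z []       []           = ↭-refl
  num-Σᵣ-*z z (f ∷ fs) (refl ∷ eqs) = ↭-trans (*-congʳ {z} (num-Σᵣ z f fs (refl ∷ eqs)))
    (↭-trans (*-assoc (sumNum (f ∷ fs)) (den (Σᵣ fs)) z)
      (*-congˡ {sumNum (f ∷ fs)} (*-comm (den (Σᵣ fs)) z)))

  renameₘ-· : ∀ ρ (d e : Monomial m) → renameₘ ρ (d · e) ≡ renameₘ ρ d · renameₘ ρ e
  renameₘ-· ρ d e = lookup-ext λ j → trans (Vec.lookup∘tabulate _ j) (trans
    (Vec.lookup-zipWith ℕ._+_ (ρ ⟨$⟩ˡ j) d e) (sym (trans
    (Vec.lookup-zipWith ℕ._+_ j (renameₘ ρ d) (renameₘ ρ e))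
    (cong₂ ℕ._+_ (Vec.lookup∘tabulate _ j) (Vec.lookup∘tabulate _ j)))))

  renameₘ-1 : ∀ ρ → renameₘ ρ (1ₘ {m}) ≡ 1ₘ
  renameₘ-1 ρ = lookup-ext λ j → trans (Vec.lookup∘tabulate _ j)
    (trans (Vec.lookup-replicate (ρ ⟨$⟩ˡ j) 0) (sym (Vec.lookup-replicate j 0)))

  renameₘ-unit : ∀ ρ (i : Fin m) → renameₘ ρ (unit i) ≡ unit (ρ ⟨$⟩ʳ i)
  renameₘ-unit ρ i = lookup-ext λ j → trans (Vec.lookup∘tabulate _ j) (entry j (ρ ⟨$⟩ʳ i Fin.≟ j))
    where
    entry : ∀ j → Dec (ρ ⟨$⟩ʳ i ≡ j) → lookup (unit i) (ρ ⟨$⟩ˡ j) ≡ lookup (unit (ρ ⟨$⟩ʳ i)) j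
    entry _ (yes refl) = trans (cong (lookup (unit i)) (inverseˡ ρ))
      (trans (Vec.lookup∘update i 1ₘ 1) (sym (Vec.lookup∘update (ρ ⟨$⟩ʳ i) 1ₘ 1)))
    entry j (no ρi≢j) = trans
      (Vec.lookup∘update′ (λ eq → ρi≢j (trans (cong (ρ ⟨$⟩ʳ_) (sym eq)) (inverseʳ ρ))) 1ₘ 1)
      (trans (Vec.lookup-replicate (ρ ⟨$⟩ˡ j) 0) (sym (trans
        (Vec.lookup∘update′ (ρi≢j ∘ sym) 1ₘ 1) (Vec.lookup-replicate j 0))))

  renameₚ-* : ∀ ρ (p q : Poly m) → renameₚ ρ (p *ₚ q) ≡ renameₚ ρ p *ₚ renameₚ ρ q
  renameₚ-* ρ []            q = refl
  renameₚ-* ρ ((a , d) ∷ p) q = trans (List.map-++ _ (map ((a , d) ·ₜ_) q) (p *ₚ q))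
    (cong₂ _++_ (trans (sym (List.map-∘ q)) (trans
      (List.map-cong (λ (b , e) → cong (a ℤ.* b ,_) (renameₘ-· ρ d e)) q) (List.map-∘ q)))
      (renameₚ-* ρ p q))

  den-Σᵣ-rename : ∀ ρ z fs → All (λ f → den f ≡ z) fs → renameₚ ρ z ↭ z →
    renameₚ ρ (den (Σᵣ fs)) ↭ den (Σᵣ fs)
  den-Σᵣ-rename ρ z []       []           z↭ =
    ↭-reflexive (cong (λ d → (1ℤ , d) ∷ []) (renameₘ-1 ρ))
  den-Σᵣ-rename ρ z (f ∷ fs) (refl ∷ eqs) z↭ = ↭-trans
    (↭-reflexive (renameₚ-* ρ z (den (Σᵣ fs))))
    (*-cong {renameₚ ρ z} {z} z↭ (den-Σᵣ-rename ρ z fs eqs z↭))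

  num-Σᵣ-rename : ∀ ρ z fs → All (λ f → den f ≡ z) fs → renameₚ ρ z ↭ z →
    renameₚ ρ (sumNum fs) ↭ sumNum fs → renameₚ ρ (num (Σᵣ fs)) ↭ num (Σᵣ fs)
  num-Σᵣ-rename ρ z []       []               z↭ s↭ = ↭-refl
  num-Σᵣ-rename ρ z (f ∷ fs) eqs@(_ ∷ eqs′) z↭ s↭ = ↭-trans
    (map⁺ _ (num-Σᵣ z f fs eqs)) (↭-trans
    (↭-reflexive (renameₚ-* ρ (sumNum (f ∷ fs)) (den (Σᵣ fs)))) (↭-trans
    (*-cong {renameₚ ρ (sumNum (f ∷ fs))} {sumNum (f ∷ fs)} s↭ (den-Σᵣ-rename ρ z fs eqs′ z↭))
    (↭-sym (num-Σᵣ z f fs eqs))))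

  -- Numerator and denominator are invariant separately, which settles the cross-multiplied equation
  -- factor by factor.
  Σᵣ-rename : ∀ ρ z fs → All (λ f → den f ≡ z) fs → renameₚ ρ z ↭ z →
    renameₚ ρ (sumNum fs) ↭ sumNum fs → rename ρ (Σᵣ fs) ≃ Σᵣ fs
  Σᵣ-rename ρ z fs eqs z↭ s↭ = ↭⇒≈ (*-cong {renameₚ ρ (num (Σᵣ fs))} {num (Σᵣ fs)}
    (num-Σᵣ-rename ρ z fs eqs z↭ s↭) (↭-sym (den-Σᵣ-rename ρ z fs eqs z↭)))

-- Symmetry of the generating functions of fillings

term : ∀ {ps n} → (Fin n → Fin n) → Filling ps n → ℤ × Monomial (suc n)
term {ps} {n} ρ σ = 1ℤ , quinv σ ∷ Weights.content ps n ρ σ (dg ps)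

t^ : ∀ {n} k → t {n} ^ₚ k ≡ (1ℤ , k ∷ 1ₘ) ∷ []
t^ zero    = refl
t^ (suc k) = trans (cong (t *ₚ_) (t^ k)) (cong (λ d → (1ℤ , suc k ∷ d) ∷ []) (·-identityˡ 1ₘ))

module _ {ps : List ℕ} {n : ℕ} where

  open Weights ps n

  wt-term : ∀ σ → wt σ ≡ term id σ ∷ []
  wt-term σ = trans (cong₂ _*ₚ_ (t^ (quinv σ)) (Π-x (dg ps)))
    (cong₂ (λ k d → (1ℤ , k ∷ d) ∷ []) (ℕ.+-identityʳ (quinv σ)) (·-identityˡ _))
    where
    Π-x : ∀ us → Πₚ (map (λ u → x (σ at u)) us) ≡ (1ℤ , 0 ∷ content id σ us) ∷ []
    Π-x []       = refl
    Π-x (u ∷ us) = cong (x (σ at u) *ₚ_) (Π-x us)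

  Σₚ-wt : ∀ σs → Σₚ (map wt σs) ≡ map (term id) σs
  Σₚ-wt []       = refl
  Σₚ-wt (σ ∷ σs) = cong₂ _++_ (wt-term σ) (Σₚ-wt σs)

  renameₚ-terms : ∀ ρ f (σs : List (Filling ps n)) →
    renameₚ (lift₀ ρ) (map (term f) σs) ≡ map (term ((ρ ⟨$⟩ʳ_) ∘ f)) σs
  renameₚ-terms ρ f σs = trans (sym (List.map-∘ σs)) (List.map-cong
    (λ σ → cong (λ d → 1ℤ , quinv σ ∷ d) (content-rename σ (dg ps))) σs)
    where
    content-rename : ∀ σ us → renameₘ ρ (content f σ us) ≡ content ((ρ ⟨$⟩ʳ_) ∘ f) σ us
    content-rename σ []       = renameₘ-1 ρ
    content-rename σ (u ∷ us) = trans (renameₘ-· ρ (unit (f (σ at u))) (content f σ us))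
      (cong₂ _·_ (renameₘ-unit ρ (f (σ at u))) (content-rename σ us))

-- Generation by transpositions of neighbours

transpose-left : ∀ {n} (i j : Fin n) → transpose i j ⟨$⟩ʳ i ≡ j
transpose-left i j rewrite dec-true (i Fin.≟ i) refl = refl

transpose-right : ∀ {n} (i j : Fin n) → transpose i j ⟨$⟩ʳ j ≡ i
transpose-right i j with j Fin.≟ i
... | yes j≡i = j≡i
... | no _ rewrite dec-true (j Fin.≟ j) refl = refl

transpose-other : ∀ {n} (i j : Fin n) {k} → k ≢ i → k ≢ j → transpose i j ⟨$⟩ʳ k ≡ k
transpose-other i j {k} k≢i k≢j
  rewrite dec-false (k Fin.≟ i) k≢i | dec-false (k Fin.≟ j) k≢j = refl

transpose-involutive : ∀ {n} (i j k : Fin n) →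
  transpose i j ⟨$⟩ʳ (transpose i j ⟨$⟩ʳ k) ≡ k
transpose-involutive i j k = go (k Fin.≟ i) (k Fin.≟ j)
  where
  go : Dec (k ≡ i) → Dec (k ≡ j) → transpose i j ⟨$⟩ʳ (transpose i j ⟨$⟩ʳ k) ≡ k
  go (yes refl) _          =
    trans (cong (transpose i j ⟨$⟩ʳ_) (transpose-left i j)) (transpose-right i j)
  go (no _)     (yes refl) =
    trans (cong (transpose i j ⟨$⟩ʳ_) (transpose-right i j)) (transpose-left i j)
  go (no k≢i)   (no k≢j)   = trans (cong (transpose i j ⟨$⟩ʳ_) (transpose-other i j k≢i k≢j))
    (transpose-other i j k≢i k≢j)

-- Bubble sort: the least m not known to be fixed by ρ is moved down from ρ m step by step.
module _ {n : ℕ} (Inv : Permutation′ n → Set)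
  (Inv-resp : ∀ {ρ τ} → (∀ i → ρ ⟨$⟩ʳ i ≡ τ ⟨$⟩ʳ i) → Inv ρ → Inv τ)
  (Inv-id : Inv Perm.id) (Inv-∘ : ∀ {ρ τ} → Inv ρ → Inv τ → Inv (ρ ∘ₚ τ))
  {ℓ : ℕ} (Inv-adjacent : ∀ {p q} → ℓ ℕ.≤ toℕ p → toℕ q ≡ suc (toℕ p) → Inv (transpose p q))
  where

  generate : ∀ k m → ℓ ℕ.≤ m → k ℕ.+ m ≡ n → ∀ ρ → (∀ i → toℕ i < m → ρ ⟨$⟩ʳ i ≡ i) → Inv ρ
  sink : ∀ k m → ℓ ℕ.≤ toℕ m → k ℕ.+ suc (toℕ m) ≡ n → ∀ d ρ →
    (∀ i → i Fin.< m → ρ ⟨$⟩ʳ i ≡ i) → toℕ (ρ ⟨$⟩ʳ m) ≡ d ℕ.+ toℕ m → Inv ρ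

  generate zero    m ℓ≤m refl ρ fix =
    Inv-resp (λ i → sym (fix i (Fin.toℕ<n i))) Inv-id
  generate (suc k) m ℓ≤m k+m≡n ρ fix = sink k M (subst (ℓ ℕ.≤_) (sym M≡m) ℓ≤m)
    (trans (cong (λ z → k ℕ.+ suc z) M≡m) (trans (ℕ.+-suc k m) k+m≡n))
    (toℕ (ρ ⟨$⟩ʳ M) ℕ.∸ toℕ M) ρ (λ i i<M → fix i (subst (toℕ i <_) M≡m i<M))
    -- If ρ(M) were below M, it would be fixed by ρ, and injectivity would force ρ(M) = M.
    (sym (ℕ.m∸n+n≡m (ℕ.≮⇒≥ λ ρM<M → ℕ.<-irrefl (cong toℕ
      (trans (sym (inverseˡ ρ)) (trans (cong (ρ ⟨$⟩ˡ_)
        (fix _ (subst (toℕ (ρ ⟨$⟩ʳ M) <_) M≡m ρM<M))) (inverseˡ ρ)))) ρM<M)))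
    where
    m<n : m < n
    m<n = subst (m <_) k+m≡n (ℕ.s≤s (ℕ.m≤n+m m k))
    M = Fin.fromℕ< m<n
    M≡m : toℕ M ≡ m
    M≡m = Fin.toℕ-fromℕ< m<n

  sink k m ℓ≤m k+m≡n zero    ρ fix ρm =
    generate k (suc (toℕ m)) (ℕ.m≤n⇒m≤1+n ℓ≤m) k+m≡n ρ fixₘ
    where
    fixₘ : ∀ i → toℕ i < suc (toℕ m) → ρ ⟨$⟩ʳ i ≡ i
    fixₘ i i<1+m with i Fin.≟ m
    ... | yes refl = Fin.toℕ-injective ρm
    ... | no i≢m   = fix i (ℕ.≤∧≢⇒< (ℕ.s≤s⁻¹ i<1+m) (i≢m ∘ Fin.toℕ-injective))
  sink k m ℓ≤m k+m≡n (suc d) ρ fix ρm = Inv-resp undo (Inv-∘ {ρ ∘ₚ transpose p q} {transpose p q}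
    (sink k m ℓ≤m k+m≡n d (ρ ∘ₚ transpose p q) fix′
      (trans (cong toℕ (transpose-right p q)) p≡))
    (Inv-adjacent ℓ≤p q≡1+p))
    where
    q = ρ ⟨$⟩ʳ m
    p<n : d ℕ.+ toℕ m < n
    p<n = ℕ.<-trans (ℕ.≤-reflexive (sym ρm)) (Fin.toℕ<n q)
    p = Fin.fromℕ< p<n
    p≡ : toℕ p ≡ d ℕ.+ toℕ m
    p≡ = Fin.toℕ-fromℕ< p<n
    q≡1+p : toℕ q ≡ suc (toℕ p)
    q≡1+p = trans ρm (cong suc (sym p≡))
    m≤p : toℕ m ℕ.≤ toℕ p
    m≤p = subst (toℕ m ℕ.≤_) (sym p≡) (ℕ.m≤n+m (toℕ m) d)
    ℓ≤p : ℓ ℕ.≤ toℕ p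
    ℓ≤p = ℕ.≤-trans ℓ≤m m≤p
    fix′ : ∀ i → i Fin.< m → (ρ ∘ₚ transpose p q) ⟨$⟩ʳ i ≡ i
    fix′ i i<m = trans (cong (transpose p q ⟨$⟩ʳ_) (fix i i<m)) (transpose-other p q
      (λ i≡p → ℕ.<-irrefl (cong toℕ i≡p) (ℕ.<-≤-trans i<m m≤p))
      (λ i≡q → ℕ.<-irrefl (trans (cong toℕ i≡q) q≡1+p) (ℕ.m≤n⇒m≤1+n (ℕ.<-≤-trans i<m m≤p))))
    undo : ∀ i → ((ρ ∘ₚ transpose p q) ∘ₚ transpose p q) ⟨$⟩ʳ i ≡ ρ ⟨$⟩ʳ i
    undo i = transpose-involutive p q (ρ ⟨$⟩ʳ i)

_≡[_]_ : ∀ {n} → Fin n → ℕ → Fin n → Set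
a ≡[ ℓ ] b = a ≡ b ⊎ (ℓ ℕ.≤ toℕ a × ℓ ℕ.≤ toℕ b)

module _ {ps : List ℕ} {n : ℕ} {ℓ : ℕ} {P : Pred (Filling ps n) 0ℓ} (P? : Decidable P)
  (P-resp : ∀ {σ τ} → (∀ u → (σ at u) ≡[ ℓ ] (τ at u)) → P σ → P τ)
  where

  open Weights ps n

  private
    L : List (Filling ps n)
    L = filter P? (Tab ps n)

  -- Renaming by τ turns the terms for ρ into those for `ρ ∘ₚ τ`. So the ρ that merely permute the
  -- terms are closed under composition, and transpositions of neighbours suffice.
  terms-sym : (ρ : Permutation′ n) → (∀ i → toℕ i < ℓ → ρ ⟨$⟩ʳ i ≡ i) → ℓ ℕ.≤ n →
    renameₚ (lift₀ ρ) (Σₚ (map wt L)) ↭ Σₚ (map wt L)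
  terms-sym ρ fix ℓ≤n = subst (λ p → renameₚ (lift₀ ρ) p ↭ p) (sym (Σₚ-wt L)) (↭-trans
    (↭-reflexive (renameₚ-terms ρ id L))
    (generate Inv (λ {ρ} {τ} → Inv-resp {ρ} {τ}) ↭-refl (λ {ρ} {τ} → Inv-∘ {ρ} {τ}) Inv-adjacent
      (n ℕ.∸ ℓ) ℓ ℕ.≤-refl (ℕ.m∸n+n≡m ℓ≤n) ρ fix))
    where
    Inv : Permutation′ n → Set
    Inv ρ = map (term (ρ ⟨$⟩ʳ_)) L ↭ map (term id) L

    content-cong : ∀ {f g} → (∀ i → f i ≡ g i) → ∀ σ us → content f σ us ≡ content g σ us
    content-cong eq σ []       = refl
    content-cong eq σ (u ∷ us) = cong₂ (λ i d → unit i · d) (eq (σ at u)) (content-cong eq σ us)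

    Inv-resp : ∀ {ρ τ} → (∀ i → ρ ⟨$⟩ʳ i ≡ τ ⟨$⟩ʳ i) → Inv ρ → Inv τ
    Inv-resp eq = ↭-trans (↭-reflexive (List.map-cong
      (λ σ → cong (λ d → 1ℤ , quinv σ ∷ d) (content-cong (sym ∘ eq) σ (dg ps))) L))

    Inv-∘ : ∀ {ρ τ} → Inv ρ → Inv τ → Inv (ρ ∘ₚ τ)
    Inv-∘ {ρ} {τ} inv-ρ inv-τ = ↭-trans (↭-reflexive (sym (renameₚ-terms τ (ρ ⟨$⟩ʳ_) L)))
      (↭-trans (map⁺ _ inv-ρ) (↭-trans (↭-reflexive (renameₚ-terms τ id L)) inv-τ))

    Inv-adjacent : ∀ {p q} → ℓ ℕ.≤ toℕ p → toℕ q ≡ suc (toℕ p) → Inv (transpose p q)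
    Inv-adjacent {p} {q} ℓ≤p q≡1+p = subst₂ _↭_ (sym (List.map-∘ L)) (sym (List.map-∘ L))
      -- For a whole filling the exponent of t is `+ quinv σ`, so the absolute value recovers
      -- `quinv σ` and leads from Laurent monomials back to terms.
      (map⁺ (λ (k , d) → 1ℤ , ∣ k ∣ ∷ d) (↭-sym (Swap.laurent-swap q≡1+p P?
        (λ σ∼τ → P-resp λ u → weaken (σ∼τ u))
        (transpose-left p q) (transpose-right p q) (transpose-other p q))))
      where
      ℓ≤q : ℓ ℕ.≤ toℕ q
      ℓ≤q = subst (ℓ ℕ.≤_) (sym q≡1+p) (ℕ.m≤n⇒m≤1+n ℓ≤p)
      large : ∀ {a} → a ≡ p ⊎ a ≡ q → ℓ ℕ.≤ toℕ a
      large (inj₁ refl) = ℓ≤p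
      large (inj₂ refl) = ℓ≤q
      weaken : ∀ {a b} → Swap._∼_ q≡1+p a b → a ≡[ ℓ ] b
      weaken (inj₁ a≡b)       = inj₁ a≡b
      weaken (inj₂ (a∈ , b∈)) = inj₂ (large a∈ , large b∈)

-- The event as a set of fillings

filter-⊎ : ∀ {X : Set} {P Q R : Pred X 0ℓ} (P? : Decidable P) (Q? : Decidable Q)
  (R? : Decidable R) → (∀ {x} → P x → ¬ Q x) → (∀ {x} → P x ⊎ Q x → R x) →
  (∀ {x} → R x → P x ⊎ Q x) → ∀ xs → filter P? xs ++ filter Q? xs ↭ filter R? xs
filter-⊎ P? Q? R? P⇒¬Q into from []       = ↭-refl
filter-⊎ P? Q? R? P⇒¬Q into from (x ∷ xs)
  with IH ← filter-⊎ P? Q? R? P⇒¬Q into from xs | P? x | Q? x | R? x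
... | yes Px | yes Qx | _      = contradiction Qx (P⇒¬Q Px)
... | yes Px | no ¬Qx | yes Rx = ↭-prep x IH
... | yes Px | no ¬Qx | no ¬Rx = contradiction (into (inj₁ Px)) ¬Rx
... | no ¬Px | yes Qx | yes Rx = ↭-trans (shift x (filter P? xs) (filter Q? xs)) (↭-prep x IH)
... | no ¬Px | yes Qx | no ¬Rx = contradiction (into (inj₂ Qx)) ¬Rx
... | no ¬Px | no ¬Qx | no ¬Rx = IH
... | no ¬Px | no ¬Qx | yes Rx with from Rx
...   | inj₁ Px = contradiction Px ¬Px
...   | inj₂ Qx = contradiction Qx ¬Qx

-- Serves twice: to distribute the columns of a filling over the sites, and the fillings over the
-- configurations.
concatMap-filter : ∀ {X W : Set} {R : X → W → Set} (R? : ∀ x w → Dec (R x w)) {ws} →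
  AllPairs (λ w w′ → ∀ x → R x w → ¬ R x w′) ws → ∀ xs →
  concatMap (λ w → filter (λ x → R? x w) xs) ws ↭ filter (λ x → any? (R? x) ws) xs
concatMap-filter R? {[]}     []           xs =
  ↭-reflexive (sym (List.filter-none _ (All.universal (λ _ ()) xs)))
concatMap-filter R? {w ∷ ws} (disj ∷ djs) xs = ↭-trans
  (++⁺ˡ (filter (λ x → R? x w) xs) (concatMap-filter R? djs xs))
  (filter-⊎ (λ x → R? x w) (λ x → any? (R? x) ws) (λ x → any? (R? x) (w ∷ ws))
    (λ Rxw any → All.lookupWith (λ d Rxw′ → d _ Rxw Rxw′) disj any)
    (λ where (inj₁ h) → here h ; (inj₂ h) → there h)
    (λ where (here h) → inj₁ h ; (there h) → inj₂ h) xs)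

bottom-letter : ∀ {n p} (c : Vec (Fin n) p) → 0 < p → ∃[ a ] valueAt c 0 ≡ suc (toℕ {n} a)
bottom-letter (a ∷ c) _ = a , refl

module _ (Λ : Partition) (n : ℕ) where

  private
    ps = parts Λ

  -- As parts are positive, every column has a bottom letter and is therefore counted at exactly one
  -- site.
  proj-isTAZRP : (σ : Filling ps n) → IsTAZRP Λ (proj σ)
  proj-isTAZRP σ = begin
    concat (toList (tabulate λ j → map (List.lookup ps) (at-site j)))
      ≡⟨ cong concat (toList-tabulate (λ j → map (List.lookup ps) (at-site j))) ⟩
    concat (map (λ j → map (List.lookup ps) (at-site j)) (allFin n))
      ≡⟨ List.map-concatMap (List.lookup ps) at-site (allFin n) ⟨
    map (List.lookup ps) (concatMap at-site (allFin n))
      ↭⟨ map⁺ (List.lookup ps) (concatMap-filter (λ i j → bottom σ i ℕ.≟ suc (toℕ j))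
           (AllPairs.map (λ j≢k i eq eq′ → j≢k (Fin.toℕ-injective
             (ℕ.suc-injective (trans (sym eq) eq′)))) (Unique.allFin⁺ n)) (allFin (length ps))) ⟩
    map (List.lookup ps) (filter (λ i → any? (λ j → bottom σ i ℕ.≟ suc (toℕ j)) (allFin n))
      (allFin (length ps)))
      ≡⟨ cong (map (List.lookup ps)) (List.filter-all _ (All.universal somewhere _)) ⟩
    map (List.lookup ps) (allFin (length ps))
      ≡⟨ trans (List.map-tabulate id (List.lookup ps)) (List.tabulate-lookup ps) ⟩
    ps ∎
    where
    open PermutationReasoning
    at-site : Fin n → List (Fin (length ps))
    at-site j = filter (λ i → bottom σ i ℕ.≟ suc (toℕ j)) (allFin (length ps))

    toList-tabulate : ∀ {A : Set} {k} (f : Fin k → A) → toList (tabulate f) ≡ map f (allFin k)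
    toList-tabulate {k = zero}  f = refl
    toList-tabulate {k = suc k} f = cong (f Fin.zero ∷_)
      (trans (toList-tabulate (f ∘ Fin.suc)) (trans (List.map-∘ (allFin k))
        (cong (map f) (List.map-tabulate id Fin.suc))))

    somewhere : ∀ i → Any (λ j → bottom σ i ≡ suc (toℕ j)) (allFin n)
    somewhere i with bottom-letter (column σ i) (All.lookup (positive Λ) (∈-lookup i))
    ... | a , eq = Any.map (λ where refl → eq) (∈-allFin a)

  module _ .{{_ : NonZero n}} {E : Pred (Config n) 0ℓ} (E? : Decidable E)
    (E-resp : ∀ {v w} → v ≈ᶜ w → E v → E w) where

    private
      module Conf = DecSetoid (Config-decSetoid n)
      ws = filter E? (TAZRP Λ n)

    -- `proj σ` is equivalent to exactly one listed configuration, so each filling in the event is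
    -- counted once; `E-resp` is needed because the list holds only representatives.
    sumNum-π : sumNum (map (π Λ n) ws) ↭ Σₚ (map wt (filter (λ σ → E? (proj σ)) (Tab ps n)))
    sumNum-π = begin
      sumNum (map (π Λ n) ws)
        ≡⟨ to-terms ws ⟩
      map (term id) (concatMap (λ w → filter (λ σ → proj σ ≈ᶜ? w) (Tab ps n)) ws)
        ↭⟨ map⁺ (term id) (concatMap-filter (λ σ w → proj σ ≈ᶜ? w)
             (AllPairs.map (λ v≉w σ σ≈v σ≈w → v≉w (Conf.trans (Conf.sym σ≈v) σ≈w))
               (AllPairs.filter⁺ E? (TAZRP-unique Λ n))) (Tab ps n)) ⟩
      map (term id) (filter (λ σ → any? (proj σ ≈ᶜ?_) ws) (Tab ps n))
        ≡⟨ cong (map (term id)) (List.filter-≐ _ _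
             ((λ {σ} → found σ (TAZRP Λ n)) , λ {σ} Eσ →
               find σ Eσ (TAZRP Λ n) (TAZRP-complete Λ n (proj σ) (proj-isTAZRP σ))) (Tab ps n)) ⟩
      map (term id) (filter (λ σ → E? (proj σ)) (Tab ps n))
        ≡⟨ Σₚ-wt _ ⟨
      Σₚ (map wt (filter (λ σ → E? (proj σ)) (Tab ps n))) ∎
      where
      open PermutationReasoning

      to-terms : ∀ ws → sumNum (map (π Λ n) ws) ≡
        map (term id) (concatMap (λ w → filter (λ σ → proj σ ≈ᶜ? w) (Tab ps n)) ws)
      to-terms []       = refl
      to-terms (w ∷ ws) = trans (cong₂ _++_ (Σₚ-wt _) (to-terms ws))
        (sym (List.map-++ (term id) (filter (λ σ → proj σ ≈ᶜ? w) (Tab ps n)) _))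

      found : ∀ (σ : Filling ps n) vs → Any (proj σ ≈ᶜ_) (filter E? vs) → E (proj σ)
      found σ (v ∷ vs) any with E? v
      ... | no _ = found σ vs any
      found σ (v ∷ vs) (here σ≈v)  | yes Ev = E-resp (Conf.sym σ≈v) Ev
      found σ (v ∷ vs) (there any) | yes _  = found σ vs any

      find : ∀ (σ : Filling ps n) → E (proj σ) → ∀ vs → Any (proj σ ≈ᶜ_) vs →
        Any (proj σ ≈ᶜ_) (filter E? vs)
      find σ Eσ (v ∷ vs) any with E? v
      find σ Eσ (v ∷ vs) (here σ≈v)  | yes _  = here σ≈v
      find σ Eσ (v ∷ vs) (there any) | yes _  = there (find σ Eσ vs any)
      find σ Eσ (v ∷ vs) (here σ≈v)  | no ¬Ev = contradiction (E-resp σ≈v Eσ) ¬Ev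
      find σ Eσ (v ∷ vs) (there any) | no _   = find σ Eσ vs any

FirstSites-resp-≈ᶜ : ∀ {ℓ n} (ℓ≤n : ℓ ℕ.≤ n) u {v w} → v ≈ᶜ w →
  FirstSites ℓ≤n u v → FirstSites ℓ≤n u w
FirstSites-resp-≈ᶜ ℓ≤n u v≈w first i =
  ↭-trans (↭-sym (VecPointwise.lookup v≈w (inject≤ i ℓ≤n))) (first i)

-- A column stands at a site j below ℓ (counted from 0) exactly if its bottom letter is j, and
-- exchanging letters that are at least ℓ neither creates nor destroys such a letter.
FirstSites-proj : ∀ {ps ℓ n} (ℓ≤n : ℓ ℕ.≤ n) u {σ τ : Filling ps n} →
  (∀ v → (σ at v) ≡[ ℓ ] (τ at v)) → FirstSites ℓ≤n u (proj σ) → FirstSites ℓ≤n u (proj τ)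
FirstSites-proj {ps} {ℓ} {n} ℓ≤n u {σ} {τ} σ≡τ first i =
  subst (_↭ lookup u i) same-site (first i)
  where
  j = inject≤ i ℓ≤n
  j<ℓ : toℕ j < ℓ
  j<ℓ = subst (_< ℓ) (sym (Fin.toℕ-inject≤ i ℓ≤n)) (Fin.toℕ<n i)

  transfer : ∀ {p} (c d : Vec (Fin n) p) → (∀ r → lookup c r ≡[ ℓ ] lookup d r) →
    valueAt c 0 ≡ suc (toℕ j) → valueAt d 0 ≡ suc (toℕ j)
  transfer []      []      c≡d ()
  transfer (a ∷ c) (b ∷ d) c≡d eq with c≡d Fin.zero
  ... | inj₁ refl      = eq
  ... | inj₂ (ℓ≤a , _) = contradiction
    (ℕ.<-≤-trans j<ℓ (subst (ℓ ℕ.≤_) (ℕ.suc-injective eq) ℓ≤a)) (ℕ.<-irrefl refl)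

  flip : ∀ {a b : Fin n} → a ≡[ ℓ ] b → b ≡[ ℓ ] a
  flip (inj₁ eq)          = inj₁ (sym eq)
  flip (inj₂ (ℓ≤a , ℓ≤b)) = inj₂ (ℓ≤b , ℓ≤a)

  same-site : lookup (proj σ) j ≡ lookup (proj τ) j
  same-site = trans (Vec.lookup∘tabulate _ j) (trans (cong (map (List.lookup ps)) (List.filter-≐ _ _
    ( (λ {k} → transfer (column σ k) (column τ k) (λ r → σ≡τ (k , r)))
    , (λ {k} → transfer (column τ k) (column σ k) (λ r → flip (σ≡τ (k , r)))))
    (allFin (length ps)))) (sym (Vec.lookup∘tabulate _ j)))

theorem1p2 : ∀ (Λ : Partition) (n : ℕ) .{{_ : NonZero n}} (ℓ : ℕ) (ℓ<n : ℓ < n)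
    (u : Vec Multiset ℓ) →
    SymmetricBeyond ℓ (Pr Λ n (FirstSites? (<⇒≤ ℓ<n) u))
theorem1p2 Λ n ℓ ℓ<n u ρ fix = Σᵣ-rename (lift₀ ρ) (partitionFunction Λ n)
  (map (π Λ n) (filter (FirstSites? ℓ≤n u) (TAZRP Λ n)))
  (All.map⁺ (All.universal (λ _ → refl) _))
  -- The partition function is the sum for the event that always holds, so `terms-sym` covers the
  -- denominator too.
  (subst (λ σs → renameₚ (lift₀ ρ) (Σₚ (map wt σs)) ↭ Σₚ (map wt σs))
    (List.filter-all (λ _ → yes tt) (All.universal (λ _ → tt) (Tab (parts Λ) n)))
    (terms-sym {ps = parts Λ} {P = λ _ → ⊤} (λ _ → yes tt) (λ _ _ → tt) ρ fix ℓ≤n))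
  (↭-trans (map⁺ _ sums) (↭-trans
    (terms-sym {ps = parts Λ} (λ σ → FirstSites? ℓ≤n u (proj σ))
      (λ {σ} {τ} → FirstSites-proj ℓ≤n u {σ} {τ}) ρ fix ℓ≤n)
    (↭-sym sums)))
  where
  ℓ≤n = <⇒≤ ℓ<n
  sums = sumNum-π Λ n (FirstSites? ℓ≤n u) (FirstSites-resp-≈ᶜ ℓ≤n u)
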